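{- (1) For each $\beta\in\{13,57\}$ there exists an extremal binary self-dual $[66,33,12]$ code with weight enumerator $W_{66,1}$ with parameter $\beta$. (2) For each $\beta\in\{24,25,26,27,39,40,41,42\}$ there exists an extremal binary self-dual $[66,33,12]$ code with weight enumerator $W_{66,3}$ with parameter $\beta$.
   Context: A binary $[n,k,d]$ code is a $k$-dimensional subspace of $\mathbb{F}_2^n$ with minimum Hamming distance $d$; it is self-dual if it equals its dual with respect to the standard inner product. A binary self-dual code of length $n$ has minimum distance $d\le 4\lfloor n/24\rfloor+6$ if $n\equiv 22\pmod{24}$ and $d\le 4\lfloor n/24\rfloor+4$ otherwise, and it is called extremal if it meets this bound; for $n=66$ this means $d=12$. The weight enumerator of a binary code is $\sum_i A_iy^i$, where $A_i$ is the number of codewords of Hamming weight $i$. A self-dual $[66,33,12]$ binary code has a weight enumerator of one of the forms $W_{66,1}=1+(858+8\beta)y^{12}+(18678-24\beta)y^{14}+\cdots$ with $0\le\beta\le 778$, $W_{66,2}=1+1690y^{12}+7990y^{14}+\cdots$, or $W_{66,3}=1+(858+8\beta)y^{12}+(18166-24\beta)y^{14}+\cdots$ with $14\le\beta\le 756$. Having weight enumerator $W_{66,1}$ (resp. $W_{66,3}$) with parameter $\beta$ means that the numbers of codewords of weights $12$ and $14$ are the displayed coefficients for that $\beta$. -}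

module Defs where

open import Data.Bool.Base using (Bool; true; false; _xor_; _∧_; if_then_else_)
import Data.Bool.Properties as Bool
open import Data.List.Base using (List; length)
import Data.List.Membership.Propositional as List
open import Data.List.Relation.Unary.Unique.Propositional using (Unique)
open import Data.Nat.Base using (ℕ; _+_; _*_; _∸_; _≤_; _≡ᵇ_)
open import Data.Nat.DivMod using (_/_; _%_)
open import Data.Product.Base using (_×_; ∃; ∃-syntax)
open import Data.Vec.Base using (Vec; []; _∷_; replicate; zipWith; map; foldr′; count; lookup)
open import Function.Bundles using (_⇔_)
open import Level using (0ℓ)
open import Relation.Binary.PropositionalEquality using (_≡_; _≢_)
open import Relation.Unary using (Pred; _∈_; _∩_; _≐_)

-- 𝔽₂ is Bool with _xor_ as addition and _∧_ as multiplication
-- (Data.Bool.Properties.xor-∧-commutativeRing).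

Word : ℕ → Set
Word n = Vec Bool n

𝟎 : ∀ {n} → Word n
𝟎 {n} = replicate n false

infixl 6 _⊕_
_⊕_ : ∀ {n} → Word n → Word n → Word n
_⊕_ = zipWith _xor_

infixr 7 _·_
_·_ : ∀ {n} → Bool → Word n → Word n
a · v = map (a ∧_) v

⟨_,_⟩ : ∀ {n} → Word n → Word n → Bool
⟨ x , y ⟩ = foldr′ _xor_ false (zipWith _∧_ x y)

wt : ∀ {n} → Word n → ℕ
wt = count (Bool._≟ true)

-- x ⊕ y is true exactly at the coordinates where x and y differ.
dist : ∀ {n} → Word n → Word n → ℕ
dist x y = wt (x ⊕ y)

linComb : ∀ {n k} → Vec Bool k → Vec (Word n) k → Word n
linComb []       []       = 𝟎
linComb (a ∷ as) (v ∷ vs) = a · v ⊕ linComb as vs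

record IsSubspace {n} (C : Pred (Word n) 0ℓ) : Set where
  field
    𝟎-mem    : 𝟎 ∈ C
    ⊕-closed : ∀ {x y} → x ∈ C → y ∈ C → x ⊕ y ∈ C
    ·-closed : ∀ a {x} → x ∈ C → a · x ∈ C

record IsBasis {n k} (C : Pred (Word n) 0ℓ) (B : Vec (Word n) k) : Set where
  field
    members     : ∀ i → lookup B i ∈ C
    independent : ∀ a → linComb a B ≡ 𝟎 → a ≡ 𝟎
    spanning    : ∀ {x} → x ∈ C → ∃[ a ] linComb a B ≡ x

HasDimension : ∀ {n} → Pred (Word n) 0ℓ → ℕ → Set
HasDimension {n} C k = ∃ λ (B : Vec (Word n) k) → IsBasis C B

record HasMinDistance {n} (C : Pred (Word n) 0ℓ) (d : ℕ) : Set where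
  field
    attained : ∃[ x ] ∃[ y ] (x ∈ C × y ∈ C × x ≢ y × dist x y ≡ d)
    minimal  : ∀ {x y} → x ∈ C → y ∈ C → x ≢ y → d ≤ dist x y

record Is[_,_,_]Code (n k d : ℕ) (C : Pred (Word n) 0ℓ) : Set where
  field
    isSubspace  : IsSubspace C
    dimension   : HasDimension C k
    minDistance : HasMinDistance C d

dual : ∀ {n} → Pred (Word n) 0ℓ → Pred (Word n) 0ℓ
dual C x = ∀ y → y ∈ C → ⟨ x , y ⟩ ≡ false

SelfDual : ∀ {n} → Pred (Word n) 0ℓ → Set
SelfDual C = C ≐ dual C

selfDualBound : ℕ → ℕ
selfDualBound n = 4 * (n / 24) + (if n % 24 ≡ᵇ 22 then 6 else 4)

Extremal : ∀ {n} → Pred (Word n) 0ℓ → Set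
Extremal {n} C = HasMinDistance C (selfDualBound n)

-- P has exactly N elements: it is enumerated, without repetition, by a list
-- of length N. (A bijection with Fin N out of a Σ-type would instead count
-- membership proofs.)
HasSize : {A : Set} → Pred A 0ℓ → ℕ → Set
HasSize {A} P N =
  ∃ λ (xs : List A) → Unique xs × length xs ≡ N × (∀ x → x ∈ P ⇔ x List.∈ xs)

-- A C i N says that the coefficient Aᵢ of the weight enumerator of C is N.
A : ∀ {n} → Pred (Word n) 0ℓ → ℕ → ℕ → Set
A C i N = HasSize (C ∩ (λ x → wt x ≡ i)) N

-- In both definitions below the upper bound on β keeps _∸_ from truncating.

HasW₆₆,₁ : Pred (Word 66) 0ℓ → ℕ → Set
HasW₆₆,₁ C β =
  0 ≤ β × β ≤ 778 × A C 12 (858 + 8 * β) × A C 14 (18678 ∸ 24 * β)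

HasW₆₆,₃ : Pred (Word 66) 0ℓ → ℕ → Set
HasW₆₆,₃ C β =
  14 ≤ β × β ≤ 756 × A C 12 (858 + 8 * β) × A C 14 (18166 ∸ 24 * β)

IsExtremalSelfDual[66,33,12] : Pred (Word 66) 0ℓ → Set
IsExtremalSelfDual[66,33,12] C = Is[ 66 , 33 , 12 ]Code C × SelfDual C × Extremal C

{-# OPTIONS --safe #-}
-- Each code has a generator matrix (𝟏 | R) with R Rᵀ = 𝟏, so both halves of the
-- coordinates are information sets. A word of weight at most 10 has weight at
-- most 5 on the left or at most 4 on the right; hence d = 12 can be read off the
-- sums of at most five rows of R and at most four columns. The words of weight
-- 12 and 14 need not be listed: since wt c / 2 mod 2 is a linear functional of
-- the codeword c, the MacWilliams identities for the code and for its shadow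
-- (the coset representing that functional) express A₁₂ and A₁₄ through the
-- numbers Bᵢ of shadow vectors of weight i,
--   A₁₂ = 858 + 832 B₁ + 112 B₅ + 8 B₉,
--   A₁₄ = 18678 − 10688 B₁ − 848 B₅ − 24 B₉,
-- and these again only involve sums of at most four rows or columns. W₆₆,₁ is
-- the case B₁ = B₅ = 0, B₉ = β, and W₆₆,₃ the case B₁ = 0, B₅ = 1, B₉ = β − 14.
module Submission where

open import Algebra.Bundles using (CommutativeRing)
import Algebra.Properties.CommutativeSemigroup as CommutativeSemigroup
open import Data.Bool.Base using (Bool; true; false; not; _xor_; _∧_; if_then_else_)
import Data.Bool.Properties as Bool
open import Data.Integer.Base as ℤ using (ℤ; +_; -[1+_]; 0ℤ; 1ℤ; -1ℤ; _+_; _*_; -_)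
import Data.Integer.Properties as ℤ
open import Data.List.Base as List using (List; []; _∷_; length; filter)
import Data.List.Membership.Propositional as List
open import Data.List.Membership.Propositional using (_∈_)
open import Data.List.Membership.Propositional.Properties
  using (∈-map⁺; ∈-map⁻; ∈-++⁺ˡ; ∈-++⁺ʳ; ∈-filter⁺; ∈-filter⁻)
import Data.List.Properties as List
open import Data.List.Relation.Unary.All using ([])
open import Data.List.Relation.Unary.AllPairs using ([]; _∷_)
open import Data.List.Relation.Unary.Any using (here; there)
open import Data.List.Relation.Unary.Unique.Propositional using (Unique)
import Data.List.Relation.Unary.Unique.Propositional.Properties as Unique
open import Data.Nat.Base as ℕ
  using (ℕ; zero; suc; _≤_; _<_; z≤n; s≤s; _≤ᵇ_; _<ᵇ_; _≡ᵇ_; ⌊_/2⌋)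
open import Data.Nat.DivMod using (_/_; _%_)
import Data.Nat.Properties as ℕ
open import Data.Product.Base using (_×_; _,_; ∃; proj₁; proj₂)
open import Data.Sum.Base using (_⊎_; inj₁; inj₂)
open import Data.Vec.Base
  using (Vec; []; _∷_; _++_; _⊛_; foldr′; lookup; map; replicate; splitAt; transpose; zipWith)
open import Data.Vec.Properties
  using ( ++-injectiveˡ; lookup-map; map-const; map-cong; map-id; map-∘; zipWith-assoc
        ; zipWith-identityˡ; zipWith-identityʳ; ≡-dec; ∷-injectiveˡ; ∷-injectiveʳ)
import Data.Vec.Relation.Unary.All as Vec
open import Function.Bundles using (mk⇔; Equivalence)
open import Level using (0ℓ)
open import Relation.Binary.PropositionalEquality
  using (_≡_; _≢_; refl; sym; trans; cong; cong₂; subst; module ≡-Reasoning)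
open import Relation.Nullary using (Dec; yes; no; does; _×-dec_; _⊎-dec_; _→-dec_)
open import Relation.Nullary.Decidable using (dec-true; dec-false; map′; toWitness)
open import Relation.Nullary.Negation using (contradiction)
open import Relation.Unary using (Decidable; Pred)
open import Defs

open CommutativeSemigroup (CommutativeRing.+-commutativeSemigroup Bool.xor-∧-commutativeRing)
  using () renaming (interchange to xor-interchange)
open CommutativeSemigroup ℕ.+-commutativeSemigroup
  using () renaming (interchange to ℕ-interchange)
open CommutativeSemigroup ℤ.+-commutativeSemigroup
  using () renaming (interchange to +-interchange; xy∙z≈xz∙y to +-swapʳ)
open CommutativeSemigroup ℤ.*-commutativeSemigroup
  using () renaming (x∙yz≈y∙xz to *-swapˡ; x∙yz≈z∙xy to *-rotate; xy∙z≈y∙xz to *-pull)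
open ≡-Reasoning

-- The code has 2³³ words, so sums over it stay symbolic: `n` is a variable in all arguments about
-- them, and evaluation is confined to the checks on R, the counts of few rows or columns, and the
-- identities at weights up to 66. The weight enumerator is never solved for. For a function f of
-- the weight with Krawtchouk transform f^, the MacWilliams identity makes 2ⁿ f - f^ sum to 0 over
-- the codeword weights, and the version for the shadow turns the sum of (-1)^(w/2) g^(w) into 2ⁿ
-- times a sum of g over the shadow. If f and g are chosen so that the combined summand vanishes at
-- every possible codeword weight except 0 and the target, summation leaves one linear equation for
-- a single coefficient. The weights 1, 5 and 9 arise because shadow weights in length 66 are
-- congruent to 33 modulo 4, while a vector of weight at most 9 has a half of weight at most 4,
-- within reach of a short search.

private variable
  m n k : ℕ

-- Vectors over 𝔽₂ and the inner product

⊕-assoc : (x y z : Word n) → (x ⊕ y) ⊕ z ≡ x ⊕ (y ⊕ z)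
⊕-assoc = zipWith-assoc Bool.xor-assoc

⊕-identityˡ : (x : Word n) → 𝟎 ⊕ x ≡ x
⊕-identityˡ = zipWith-identityˡ (λ _ → refl)

⊕-identityʳ : (x : Word n) → x ⊕ 𝟎 ≡ x
⊕-identityʳ = zipWith-identityʳ Bool.xor-identityʳ

⊕-self : (x : Word n) → x ⊕ x ≡ 𝟎
⊕-self []      = refl
⊕-self (a ∷ x) = cong₂ _∷_ (Bool.xor-same a) (⊕-self x)

⊕-cancel : (x y : Word n) → x ⊕ (x ⊕ y) ≡ y
⊕-cancel x y = begin
  x ⊕ (x ⊕ y) ≡⟨ ⊕-assoc x x y ⟨
  x ⊕ x ⊕ y   ≡⟨ cong (_⊕ y) (⊕-self x) ⟩
  𝟎 ⊕ y       ≡⟨ ⊕-identityˡ y ⟩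
  y           ∎

⊕≡𝟎⇒≡ : (x y : Word n) → x ⊕ y ≡ 𝟎 → x ≡ y
⊕≡𝟎⇒≡ x y eq = begin
  x           ≡⟨ ⊕-identityʳ x ⟨
  x ⊕ 𝟎       ≡⟨ cong (x ⊕_) eq ⟨
  x ⊕ (x ⊕ y) ≡⟨ ⊕-cancel x y ⟩
  y           ∎

⊕-interchange : (x y z w : Word n) → (x ⊕ y) ⊕ (z ⊕ w) ≡ (x ⊕ z) ⊕ (y ⊕ w)
⊕-interchange []      []      []      []      = refl
⊕-interchange (a ∷ x) (b ∷ y) (c ∷ z) (d ∷ w) =
  cong₂ _∷_ (xor-interchange a b c d) (⊕-interchange x y z w)

++-⊕ : (x x′ : Word m) (y y′ : Word n) → (x ++ y) ⊕ (x′ ++ y′) ≡ (x ⊕ x′) ++ (y ⊕ y′)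
++-⊕ []      []        y y′ = refl
++-⊕ (a ∷ x) (a′ ∷ x′) y y′ = cong (_ ∷_) (++-⊕ x x′ y y′)

𝟎-++ : ∀ m → 𝟎 {m} ++ 𝟎 {n} ≡ 𝟎
𝟎-++ zero    = refl
𝟎-++ (suc m) = cong (false ∷_) (𝟎-++ m)

true-· : (x : Word n) → true · x ≡ x
true-· = map-id

false-· : (x : Word n) → false · x ≡ 𝟎
false-· x = map-const x false

·-distribʳ : ∀ a b (x : Word n) → (a xor b) · x ≡ a · x ⊕ b · x
·-distribʳ a b []      = refl
·-distribʳ a b (c ∷ x) = cong₂ _∷_ (Bool.∧-distribʳ-xor c a b) (·-distribʳ a b x)

⟨⟩-comm : (x y : Word n) → ⟨ x , y ⟩ ≡ ⟨ y , x ⟩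
⟨⟩-comm []      []      = refl
⟨⟩-comm (a ∷ x) (b ∷ y) = cong₂ _xor_ (Bool.∧-comm a b) (⟨⟩-comm x y)

⟨⟩-⊕ˡ : (x y z : Word n) → ⟨ x ⊕ y , z ⟩ ≡ ⟨ x , z ⟩ xor ⟨ y , z ⟩
⟨⟩-⊕ˡ []      []      []      = refl
⟨⟩-⊕ˡ (a ∷ x) (b ∷ y) (c ∷ z) = begin
  ((a xor b) ∧ c) xor ⟨ x ⊕ y , z ⟩                     ≡⟨ cong₂ _xor_ (Bool.∧-distribʳ-xor c a b) (⟨⟩-⊕ˡ x y z) ⟩
  ((a ∧ c) xor (b ∧ c)) xor (⟨ x , z ⟩ xor ⟨ y , z ⟩)   ≡⟨ xor-interchange (a ∧ c) (b ∧ c) _ _ ⟩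
  ((a ∧ c) xor ⟨ x , z ⟩) xor ((b ∧ c) xor ⟨ y , z ⟩)   ∎

⟨⟩-⊕ʳ : (x y z : Word n) → ⟨ x , y ⊕ z ⟩ ≡ ⟨ x , y ⟩ xor ⟨ x , z ⟩
⟨⟩-⊕ʳ x y z = begin
  ⟨ x , y ⊕ z ⟩             ≡⟨ ⟨⟩-comm x (y ⊕ z) ⟩
  ⟨ y ⊕ z , x ⟩             ≡⟨ ⟨⟩-⊕ˡ y z x ⟩
  ⟨ y , x ⟩ xor ⟨ z , x ⟩   ≡⟨ cong₂ _xor_ (⟨⟩-comm y x) (⟨⟩-comm z x) ⟩
  ⟨ x , y ⟩ xor ⟨ x , z ⟩   ∎

⟨⟩-𝟎ˡ : (x : Word n) → ⟨ 𝟎 , x ⟩ ≡ false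
⟨⟩-𝟎ˡ []      = refl
⟨⟩-𝟎ˡ (_ ∷ x) = ⟨⟩-𝟎ˡ x

⟨⟩-𝟎ʳ : (x : Word n) → ⟨ x , 𝟎 ⟩ ≡ false
⟨⟩-𝟎ʳ x = trans (⟨⟩-comm x 𝟎) (⟨⟩-𝟎ˡ x)

⟨⟩-·ˡ : ∀ a (x y : Word n) → ⟨ a · x , y ⟩ ≡ a ∧ ⟨ x , y ⟩
⟨⟩-·ˡ true  x y = cong ⟨_, y ⟩ (true-· x)
⟨⟩-·ˡ false x y = trans (cong ⟨_, y ⟩ (false-· x)) (⟨⟩-𝟎ˡ y)

⟨⟩-++ : (x x′ : Word m) (y y′ : Word n) → ⟨ x ++ y , x′ ++ y′ ⟩ ≡ ⟨ x , x′ ⟩ xor ⟨ y , y′ ⟩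
⟨⟩-++ []      []        y y′ = refl
⟨⟩-++ (a ∷ x) (a′ ∷ x′) y y′ = begin
  (a ∧ a′) xor ⟨ x ++ y , x′ ++ y′ ⟩         ≡⟨ cong ((a ∧ a′) xor_) (⟨⟩-++ x x′ y y′) ⟩
  (a ∧ a′) xor (⟨ x , x′ ⟩ xor ⟨ y , y′ ⟩)   ≡⟨ Bool.xor-assoc (a ∧ a′) _ _ ⟨
  ((a ∧ a′) xor ⟨ x , x′ ⟩) xor ⟨ y , y′ ⟩   ∎

⟨⟩-nondegenerate : (w : Word n) → (∀ x → ⟨ x , w ⟩ ≡ false) → w ≡ 𝟎
⟨⟩-nondegenerate []      _  = refl
⟨⟩-nondegenerate (a ∷ w) ⊥w = cong₂ _∷_
  (begin
    a               ≡⟨ Bool.xor-identityʳ a ⟨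
    a xor false     ≡⟨ cong (a xor_) (⟨⟩-𝟎ˡ w) ⟨
    a xor ⟨ 𝟎 , w ⟩ ≡⟨ ⊥w (true ∷ 𝟎) ⟩
    false           ∎)
  (⟨⟩-nondegenerate w λ x → ⊥w (false ∷ x))

-- Linear combinations as matrix products

linComb-𝟎 : (M : Vec (Word n) k) → linComb 𝟎 M ≡ 𝟎
linComb-𝟎 []      = refl
linComb-𝟎 (r ∷ M) = begin
  false · r ⊕ linComb 𝟎 M   ≡⟨ cong₂ _⊕_ (false-· r) (linComb-𝟎 M) ⟩
  𝟎 ⊕ 𝟎                     ≡⟨ ⊕-identityˡ 𝟎 ⟩
  𝟎                         ∎

linComb-false : (a : Word k) (r : Word n) (M : Vec (Word n) k) → linComb (false ∷ a) (r ∷ M) ≡ linComb a M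
linComb-false a r M = trans (cong (_⊕ linComb a M) (false-· r)) (⊕-identityˡ _)

linComb-true : (a : Word k) (r : Word n) (M : Vec (Word n) k) → linComb (true ∷ a) (r ∷ M) ≡ r ⊕ linComb a M
linComb-true a r M = cong (_⊕ linComb a M) (true-· r)

linComb-⊕ : (a b : Word k) (M : Vec (Word n) k) → linComb (a ⊕ b) M ≡ linComb a M ⊕ linComb b M
linComb-⊕ []      []      []      = sym (⊕-identityˡ 𝟎)
linComb-⊕ (a ∷ as) (b ∷ bs) (r ∷ M) = begin
  (a xor b) · r ⊕ linComb (as ⊕ bs) M                 ≡⟨ cong₂ _⊕_ (·-distribʳ a b r) (linComb-⊕ as bs M) ⟩
  (a · r ⊕ b · r) ⊕ (linComb as M ⊕ linComb bs M)     ≡⟨ ⊕-interchange (a · r) (b · r) _ _ ⟩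
  (a · r ⊕ linComb as M) ⊕ (b · r ⊕ linComb bs M)     ∎

linComb-· : ∀ c (a : Word k) (M : Vec (Word n) k) → linComb (c · a) M ≡ c · linComb a M
linComb-· true  a M = begin
  linComb (true · a) M   ≡⟨ cong (λ b → linComb b M) (true-· a) ⟩
  linComb a M            ≡⟨ true-· _ ⟨
  true · linComb a M     ∎
linComb-· false a M = begin
  linComb (false · a) M  ≡⟨ cong (λ b → linComb b M) (false-· a) ⟩
  linComb 𝟎 M            ≡⟨ linComb-𝟎 M ⟩
  𝟎                      ≡⟨ false-· _ ⟨
  false · linComb a M    ∎

-- Associativity of the matrix product: `linComb a M` is the row vector a times M, and mapping
-- `linComb _ N` over the rows of M gives MN.
linComb-linComb : (a : Word k) (M : Vec (Word m) k) (N : Vec (Word n) m) →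
  linComb a (map (λ r → linComb r N) M) ≡ linComb (linComb a M) N
linComb-linComb []       []      N = sym (linComb-𝟎 N)
linComb-linComb (a ∷ as) (r ∷ M) N = begin
  a · linComb r N ⊕ linComb as (map (λ r → linComb r N) M)   ≡⟨ cong₂ _⊕_ (sym (linComb-· a r N)) (linComb-linComb as M N) ⟩
  linComb (a · r) N ⊕ linComb (linComb as M) N               ≡⟨ linComb-⊕ (a · r) _ N ⟨
  linComb (a · r ⊕ linComb as M) N                           ∎

linComb-map-false∷ : (a : Word k) (M : Vec (Word n) k) → linComb a (map (false ∷_) M) ≡ false ∷ linComb a M
linComb-map-false∷ []       []      = refl
linComb-map-false∷ (a ∷ as) (r ∷ M) = begin
  a · (false ∷ r) ⊕ linComb as (map (false ∷_) M)   ≡⟨ cong (a · (false ∷ r) ⊕_) (linComb-map-false∷ as M) ⟩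
  ((a ∧ false) xor false) ∷ (a · r ⊕ linComb as M)  ≡⟨ cong (λ b → (b xor false) ∷ (a · r ⊕ linComb as M)) (Bool.∧-zeroʳ a) ⟩
  false ∷ (a · r ⊕ linComb as M)                    ∎

linComb-zipWith-++ : (a : Word k) (M : Vec (Word m) k) (N : Vec (Word n) k) →
  linComb a (zipWith _++_ M N) ≡ linComb a M ++ linComb a N
linComb-zipWith-++ {m = m} []       []      []      = sym (𝟎-++ m)
linComb-zipWith-++         (a ∷ as) (r ∷ M) (s ∷ N) = begin
  a · (r ++ s) ⊕ linComb as (zipWith _++_ M N)              ≡⟨ cong₂ _⊕_ (·-++ a r s) (linComb-zipWith-++ as M N) ⟩
  (a · r ++ a · s) ⊕ (linComb as M ++ linComb as N)         ≡⟨ ++-⊕ (a · r) _ (a · s) _ ⟩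
  (a · r ⊕ linComb as M) ++ (a · s ⊕ linComb as N)          ∎
  where
  ·-++ : ∀ a (x : Word m) (y : Word n) → a · (x ++ y) ≡ a · x ++ a · y
  ·-++ a []      y = refl
  ·-++ a (b ∷ x) y = cong (_ ∷_) (·-++ a x y)

𝟏 : ∀ n → Vec (Word n) n
𝟏 zero    = []
𝟏 (suc n) = (true ∷ 𝟎) ∷ map (false ∷_) (𝟏 n)

linComb-𝟏 : (a : Word n) → linComb a (𝟏 n) ≡ a
linComb-𝟏 []       = refl
linComb-𝟏 {suc n} (a ∷ as) = begin
  a · (true ∷ 𝟎) ⊕ linComb as (map (false ∷_) (𝟏 n))      ≡⟨ cong (a · (true ∷ 𝟎) ⊕_) (linComb-map-false∷ as (𝟏 n)) ⟩
  ((a ∧ true) xor false) ∷ (a · 𝟎 ⊕ linComb as (𝟏 n))     ≡⟨ cong₂ _∷_ (trans (Bool.xor-identityʳ _) (Bool.∧-identityʳ a)) (cong₂ _⊕_ (·-𝟎 a) (linComb-𝟏 as)) ⟩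
  a ∷ (𝟎 ⊕ as)                                            ≡⟨ cong (a ∷_) (⊕-identityˡ as) ⟩
  a ∷ as                                                  ∎
  where
  ·-𝟎 : ∀ a → a · 𝟎 {n} ≡ 𝟎
  ·-𝟎 true  = true-· 𝟎
  ·-𝟎 false = false-· 𝟎

𝟏-linComb : (M : Vec (Word n) k) → map (λ e → linComb e M) (𝟏 k) ≡ M
𝟏-linComb []      = refl
𝟏-linComb {k = suc k} (r ∷ M) = cong₂ _∷_
  (begin
    linComb (true ∷ 𝟎) (r ∷ M)   ≡⟨ linComb-true 𝟎 r M ⟩
    r ⊕ linComb 𝟎 M              ≡⟨ cong (r ⊕_) (linComb-𝟎 M) ⟩
    r ⊕ 𝟎                        ≡⟨ ⊕-identityʳ r ⟩
    r                            ∎)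
  (begin
    map (λ e → linComb e (r ∷ M)) (map (false ∷_) (𝟏 k))   ≡⟨ map-∘ _ _ (𝟏 k) ⟨
    map (λ e → linComb (false ∷ e) (r ∷ M)) (𝟏 k)          ≡⟨ map-cong (λ e → linComb-false e r M) (𝟏 k) ⟩
    map (λ e → linComb e M) (𝟏 k)                          ≡⟨ 𝟏-linComb M ⟩
    M                                                      ∎)

⟨linComb,⟩ : (a : Word k) (M : Vec (Word n) k) (y : Word n) → ⟨ linComb a M , y ⟩ ≡ ⟨ a , map ⟨_, y ⟩ M ⟩
⟨linComb,⟩ []       []      y = ⟨⟩-𝟎ˡ y
⟨linComb,⟩ (a ∷ as) (r ∷ M) y = begin
  ⟨ a · r ⊕ linComb as M , y ⟩                ≡⟨ ⟨⟩-⊕ˡ (a · r) _ y ⟩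
  ⟨ a · r , y ⟩ xor ⟨ linComb as M , y ⟩      ≡⟨ cong₂ _xor_ (⟨⟩-·ˡ a r y) (⟨linComb,⟩ as M y) ⟩
  (a ∧ ⟨ r , y ⟩) xor ⟨ as , map ⟨_, y ⟩ M ⟩  ∎

linComb-transpose : (y : Word n) (M : Vec (Word n) k) → linComb y (transpose M) ≡ map ⟨_, y ⟩ M
linComb-transpose {n} y []      = linComb-empty y
  where
  linComb-empty : ∀ {k} (y : Word k) → linComb y (replicate k []) ≡ []
  linComb-empty []      = refl
  linComb-empty (b ∷ y) = cong ((b · []) ⊕_) (linComb-empty y)
linComb-transpose y (r ∷ M) =
  trans (linComb-∷ y r (transpose M)) (cong₂ _∷_ (⟨⟩-comm y r) (linComb-transpose y M))
  where
  linComb-∷ : ∀ {k n} (y r : Word k) (N : Vec (Word n) k) →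
    linComb y ((replicate k _∷_ ⊛ r) ⊛ N) ≡ ⟨ y , r ⟩ ∷ linComb y N
  linComb-∷ []      []      []      = refl
  linComb-∷ (b ∷ y) (c ∷ r) (x ∷ N) = cong (b · (c ∷ x) ⊕_) (linComb-∷ y r N)

-- The transpose is the adjoint. This form isolates the vector `a` in the pairing, so that a
-- character sum over `a` can be evaluated.
⟨linComb,⟩-transpose : (a : Word k) (M : Vec (Word n) k) (y : Word n) →
  ⟨ linComb a M , y ⟩ ≡ ⟨ a , linComb y (transpose M) ⟩
⟨linComb,⟩-transpose a M y = begin
  ⟨ linComb a M , y ⟩               ≡⟨ ⟨linComb,⟩ a M y ⟩
  ⟨ a , map ⟨_, y ⟩ M ⟩             ≡⟨ cong ⟨ a ,_⟩ (linComb-transpose y M) ⟨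
  ⟨ a , linComb y (transpose M) ⟩   ∎

-- Sums and characters on 𝔽₂ⁿ

∑ : (Word n → ℤ) → ℤ
∑ {zero}  f = f []
∑ {suc n} f = ∑ (λ x → f (false ∷ x)) + ∑ (λ x → f (true ∷ x))

∑-cong : {f g : Word n → ℤ} → (∀ x → f x ≡ g x) → ∑ f ≡ ∑ g
∑-cong {zero}  f≗g = f≗g []
∑-cong {suc n} f≗g = cong₂ _+_ (∑-cong λ x → f≗g (false ∷ x)) (∑-cong λ x → f≗g (true ∷ x))

∑-+ : (f g : Word n → ℤ) → ∑ (λ x → f x + g x) ≡ ∑ f + ∑ g
∑-+ {zero}  f g = refl
∑-+ {suc n} f g = trans
  (cong₂ _+_ (∑-+ {n} (λ x → f (false ∷ x)) λ x → g (false ∷ x)) (∑-+ {n} (λ x → f (true ∷ x)) λ x → g (true ∷ x)))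
  (+-interchange (∑ {n} λ x → f (false ∷ x)) (∑ {n} λ x → g (false ∷ x)) (∑ {n} λ x → f (true ∷ x)) (∑ {n} λ x → g (true ∷ x)))

∑-*ˡ : ∀ c (f : Word n → ℤ) → ∑ (λ x → c * f x) ≡ c * ∑ f
∑-*ˡ {zero}  c f = refl
∑-*ˡ {suc n} c f = trans
  (cong₂ _+_ (∑-*ˡ c λ x → f (false ∷ x)) (∑-*ˡ c λ x → f (true ∷ x)))
  (sym (ℤ.*-distribˡ-+ c (∑ {n} λ x → f (false ∷ x)) (∑ {n} λ x → f (true ∷ x))))

∑-0 : ∑ {n} (λ _ → 0ℤ) ≡ 0ℤ
∑-0 {zero}  = refl
∑-0 {suc n} = cong₂ _+_ (∑-0 {n}) (∑-0 {n})

∑-comm : (f : Word m → Word n → ℤ) → ∑ (λ x → ∑ λ y → f x y) ≡ ∑ (λ y → ∑ λ x → f x y)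
∑-comm {zero}  f = refl
∑-comm {suc m} f = trans
  (cong₂ _+_ (∑-comm {m} λ x → f (false ∷ x)) (∑-comm {m} λ x → f (true ∷ x)))
  (sym (∑-+ (λ y → ∑ {m} λ x → f (false ∷ x) y) (λ y → ∑ {m} λ x → f (true ∷ x) y)))

∑-++ : ∀ m (f : Word (m ℕ.+ n) → ℤ) → ∑ f ≡ ∑ {m} (λ x → ∑ λ y → f (x ++ y))
∑-++ zero    f = refl
∑-++ (suc m) f = cong₂ _+_ (∑-++ m λ x → f (false ∷ x)) (∑-++ m λ x → f (true ∷ x))

∑-⊕ : (u : Word n) (f : Word n → ℤ) → ∑ (λ x → f (u ⊕ x)) ≡ ∑ f
∑-⊕ []          f = refl
∑-⊕ (false ∷ u) f = cong₂ _+_ (∑-⊕ u _) (∑-⊕ u _)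
∑-⊕ (true ∷ u)  f = trans (cong₂ _+_ (∑-⊕ u _) (∑-⊕ u _)) (ℤ.+-comm (∑ λ x → f (true ∷ x)) _)

δ : Word n → ℤ
δ []          = 1ℤ
δ (false ∷ x) = δ x
δ (true ∷ x)  = 0ℤ

δ-𝟎 : δ (𝟎 {n}) ≡ 1ℤ
δ-𝟎 {zero}  = refl
δ-𝟎 {suc n} = δ-𝟎 {n}

δ-≢𝟎 : {x : Word n} → x ≢ 𝟎 → δ x ≡ 0ℤ
δ-≢𝟎 {x = []}        x≢𝟎 = contradiction refl x≢𝟎
δ-≢𝟎 {x = false ∷ x} x≢𝟎 = δ-≢𝟎 λ eq → x≢𝟎 (cong (false ∷_) eq)
δ-≢𝟎 {x = true ∷ x}  x≢𝟎 = refl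

δ-cong : {x : Word m} {y : Word n} → (x ≡ 𝟎 → y ≡ 𝟎) → (y ≡ 𝟎 → x ≡ 𝟎) → δ x ≡ δ y
δ-cong {m} {n} {x} {y} to from with ≡-dec Bool._≟_ x 𝟎
... | yes x≡𝟎 = trans (trans (cong δ x≡𝟎) (δ-𝟎 {m})) (sym (trans (cong δ (to x≡𝟎)) (δ-𝟎 {n})))
... | no  x≢𝟎 = trans (δ-≢𝟎 x≢𝟎) (sym (δ-≢𝟎 λ y≡𝟎 → x≢𝟎 (from y≡𝟎)))

∑-δ : (w : Word n) (f : Word n → ℤ) → ∑ (λ x → f x * δ (x ⊕ w)) ≡ f w
∑-δ []          f = ℤ.*-identityʳ _
∑-δ {suc n} (false ∷ w) f = begin
  ∑ (λ x → f (false ∷ x) * δ (x ⊕ w)) + ∑ (λ x → f (true ∷ x) * 0ℤ)  ≡⟨ cong₂ _+_ (∑-δ w λ x → f (false ∷ x)) (trans (∑-cong λ x → ℤ.*-zeroʳ (f (true ∷ x))) (∑-0 {n})) ⟩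
  f (false ∷ w) + 0ℤ                                                ≡⟨ ℤ.+-identityʳ _ ⟩
  f (false ∷ w)                                                     ∎
∑-δ {suc n} (true ∷ w) f = begin
  ∑ (λ x → f (false ∷ x) * 0ℤ) + ∑ (λ x → f (true ∷ x) * δ (x ⊕ w))  ≡⟨ cong₂ _+_ (trans (∑-cong λ x → ℤ.*-zeroʳ (f (false ∷ x))) (∑-0 {n})) (∑-δ w λ x → f (true ∷ x)) ⟩
  0ℤ + f (true ∷ w)                                                 ≡⟨ ℤ.+-identityˡ _ ⟩
  f (true ∷ w)                                                      ∎

χ : Bool → ℤ
χ false = 1ℤ
χ true  = -1ℤ

χ-xor : ∀ a b → χ (a xor b) ≡ χ a * χ b
χ-xor false b     = sym (ℤ.*-identityˡ (χ b))
χ-xor true  false = refl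
χ-xor true  true  = refl

-- Orthogonality of characters: at a coordinate where `w` is 1, the two halves of the sum are
-- negatives of each other.
∑-χ : (w : Word n) → ∑ (λ a → χ ⟨ a , w ⟩) ≡ + (2 ℕ.^ n) * δ w
∑-χ []          = refl
∑-χ {suc n} (false ∷ w) = begin
  ∑ (λ a → χ ⟨ a , w ⟩) + ∑ (λ a → χ ⟨ a , w ⟩)   ≡⟨ cong₂ _+_ (∑-χ w) (∑-χ w) ⟩
  + p * δ w + + p * δ w                           ≡⟨ ℤ.*-distribʳ-+ (δ w) (+ p) (+ p) ⟨
  (+ p + + p) * δ w                               ≡⟨ cong (λ q → + (p ℕ.+ q) * δ w) (ℕ.+-identityʳ p) ⟨
  + (2 ℕ.^ suc n) * δ w                           ∎
  where p = 2 ℕ.^ n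
∑-χ {suc n} (true ∷ w) = begin
  s + ∑ (λ a → χ (not ⟨ a , w ⟩))         ≡⟨ cong (λ t → s + t) (∑-cong λ a → χ-xor true ⟨ a , w ⟩) ⟩
  s + ∑ (λ a → -1ℤ * χ ⟨ a , w ⟩)         ≡⟨ cong (λ t → s + t) (∑-*ˡ -1ℤ λ a → χ ⟨ a , w ⟩) ⟩
  s + -1ℤ * s                             ≡⟨ cong (λ t → s + t) (ℤ.-1*i≡-i s) ⟩
  s + - s                                 ≡⟨ ℤ.+-inverseʳ s ⟩
  0ℤ                                      ≡⟨ ℤ.*-zeroʳ (+ (2 ℕ.^ suc n)) ⟨
  + (2 ℕ.^ suc n) * 0ℤ                    ∎
  where s = ∑ λ a → χ ⟨ a , w ⟩

-- Functions of the weight and the Krawtchouk transform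

nth : {A : Set} → A → List A → ℕ → A
nth d []      _       = d
nth d (x ∷ l) zero    = x
nth d (x ∷ l) (suc i) = nth d l i

-- A list is a function of the weight, extended by 0. With E the shift of the argument, this is 1 +
-- E or 1 - E: what remains of such a function after one coordinate is summed out against the
-- character given by `b`.
diff : Bool → List ℤ → List ℤ
diff b []          = []
diff b (x ∷ [])    = x ∷ []
diff b (x ∷ y ∷ l) = x + χ b * y ∷ diff b (y ∷ l)

nth-diff : ∀ b l i → nth 0ℤ (diff b l) i ≡ nth 0ℤ l i + χ b * nth 0ℤ l (suc i)
nth-diff b []          i       = cong (λ t → 0ℤ + t) (sym (ℤ.*-zeroʳ (χ b)))
nth-diff b (x ∷ [])    zero    = sym (trans (cong (λ t → x + t) (ℤ.*-zeroʳ (χ b))) (ℤ.+-identityʳ x))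
nth-diff b (x ∷ [])    (suc i) = cong (λ t → 0ℤ + t) (sym (ℤ.*-zeroʳ (χ b)))
nth-diff b (x ∷ y ∷ l) zero    = refl
nth-diff b (x ∷ y ∷ l) (suc i) = nth-diff b (y ∷ l) i

diff-comm : ∀ a b l → diff a (diff b l) ≡ diff b (diff a l)
diff-comm a b []              = refl
diff-comm a b (x ∷ [])        = refl
diff-comm a b (x ∷ y ∷ [])    = cong (_∷ y ∷ []) (+-swapʳ x (χ b * y) (χ a * y))
diff-comm a b (x ∷ y ∷ z ∷ l) = cong₂ _∷_ head-comm (diff-comm a b (y ∷ z ∷ l))
  where
  head-comm : x + χ b * y + χ a * (y + χ b * z) ≡ x + χ a * y + χ b * (y + χ a * z)
  head-comm = begin
    x + χ b * y + χ a * (y + χ b * z)             ≡⟨ cong (λ t → x + χ b * y + t) (ℤ.*-distribˡ-+ (χ a) y _) ⟩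
    x + χ b * y + (χ a * y + χ a * (χ b * z))     ≡⟨ +-interchange x (χ b * y) (χ a * y) _ ⟩
    x + χ a * y + (χ b * y + χ a * (χ b * z))     ≡⟨ cong (λ t → x + χ a * y + (χ b * y + t)) (*-swapˡ (χ a) (χ b) z) ⟩
    x + χ a * y + (χ b * y + χ b * (χ a * z))     ≡⟨ cong (λ t → x + χ a * y + t) (ℤ.*-distribˡ-+ (χ b) y _) ⟨
    x + χ a * y + χ b * (y + χ a * z)             ∎

-- For j ≤ n this is ((1 - E)ʲ (1 + E)ⁿ⁻ʲ l)(0), that is, the sum of lᵢ Kᵢ(j) with the Krawtchouk
-- polynomials Kᵢ of length n.
krawtchouk : (n j : ℕ) → List ℤ → ℤ
krawtchouk zero    _       l = nth 0ℤ l 0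
krawtchouk (suc n) zero    l = krawtchouk n zero (diff false l)
krawtchouk (suc n) (suc j) l = krawtchouk n j (diff true l)

-- The operators 1 + E and 1 - E commute. `krawtchouk` applies all factors 1 - E first, whereas a
-- word has its zeros and ones in any order; this moves a zero past the ones.
krawtchouk-false : ∀ {n j} → j ≤ n → ∀ l → krawtchouk n j (diff false l) ≡ krawtchouk (suc n) j l
krawtchouk-false z≤n             l = refl
krawtchouk-false {suc n} {suc j} (s≤s j≤n) l = begin
  krawtchouk n j (diff true (diff false l))   ≡⟨ cong (krawtchouk n j) (diff-comm true false l) ⟩
  krawtchouk n j (diff false (diff true l))   ≡⟨ krawtchouk-false j≤n (diff true l) ⟩
  krawtchouk (suc n) j (diff true l)          ∎

wt≤n : (x : Word n) → wt x ≤ n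
wt≤n []          = z≤n
wt≤n (false ∷ x) = ℕ.m≤n⇒m≤1+n (wt≤n x)
wt≤n (true ∷ x)  = s≤s (wt≤n x)

-- Summing out the coordinates one at a time keeps the summand a function of the weight of the
-- remaining ones, so the sum depends on `c` only through `wt c`.
∑-krawtchouk : (c : Word n) (l : List ℤ) →
  ∑ (λ x → χ ⟨ x , c ⟩ * nth 0ℤ l (wt x)) ≡ krawtchouk n (wt c) l
∑-krawtchouk []      l = ℤ.*-identityˡ (nth 0ℤ l 0)
∑-krawtchouk {suc n} (b ∷ c) l = begin
  ∑ (λ x → χ ⟨ x , c ⟩ * nth 0ℤ l (wt x)) + ∑ (λ x → χ (b xor ⟨ x , c ⟩) * nth 0ℤ l (suc (wt x)))
    ≡⟨ ∑-+ (λ x → χ ⟨ x , c ⟩ * nth 0ℤ l (wt x)) (λ x → χ (b xor ⟨ x , c ⟩) * nth 0ℤ l (suc (wt x))) ⟨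
  ∑ (λ x → χ ⟨ x , c ⟩ * nth 0ℤ l (wt x) + χ (b xor ⟨ x , c ⟩) * nth 0ℤ l (suc (wt x)))
    ≡⟨ ∑-cong pointwise ⟩
  ∑ (λ x → χ ⟨ x , c ⟩ * nth 0ℤ (diff b l) (wt x))
    ≡⟨ ∑-krawtchouk c (diff b l) ⟩
  krawtchouk n (wt c) (diff b l)
    ≡⟨ step b ⟩
  krawtchouk (suc n) (wt (b ∷ c)) l ∎
  where
  pointwise : ∀ x → χ ⟨ x , c ⟩ * nth 0ℤ l (wt x) + χ (b xor ⟨ x , c ⟩) * nth 0ℤ l (suc (wt x))
            ≡ χ ⟨ x , c ⟩ * nth 0ℤ (diff b l) (wt x)
  pointwise x = begin
    χ ⟨ x , c ⟩ * nth 0ℤ l (wt x) + χ (b xor ⟨ x , c ⟩) * nth 0ℤ l (suc (wt x))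
      ≡⟨ cong (λ s → χ ⟨ x , c ⟩ * nth 0ℤ l (wt x) + s * nth 0ℤ l (suc (wt x))) (χ-xor b _) ⟩
    χ ⟨ x , c ⟩ * nth 0ℤ l (wt x) + χ b * χ ⟨ x , c ⟩ * nth 0ℤ l (suc (wt x))
      ≡⟨ cong (λ t → χ ⟨ x , c ⟩ * nth 0ℤ l (wt x) + t) (*-pull (χ b) (χ ⟨ x , c ⟩) _) ⟩
    χ ⟨ x , c ⟩ * nth 0ℤ l (wt x) + χ ⟨ x , c ⟩ * (χ b * nth 0ℤ l (suc (wt x)))
      ≡⟨ ℤ.*-distribˡ-+ (χ ⟨ x , c ⟩) _ _ ⟨
    χ ⟨ x , c ⟩ * (nth 0ℤ l (wt x) + χ b * nth 0ℤ l (suc (wt x)))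
      ≡⟨ cong (χ ⟨ x , c ⟩ *_) (nth-diff b l (wt x)) ⟨
    χ ⟨ x , c ⟩ * nth 0ℤ (diff b l) (wt x) ∎

  step : ∀ b → krawtchouk n (wt c) (diff b l) ≡ krawtchouk (suc n) (wt (b ∷ c)) l
  step false = krawtchouk-false (wt≤n c) l
  step true  = refl

wt-++ : (x : Word m) (y : Word n) → wt (x ++ y) ≡ wt x ℕ.+ wt y
wt-++ []          y = refl
wt-++ (false ∷ x) y = wt-++ x y
wt-++ (true ∷ x)  y = cong suc (wt-++ x y)

indicator : ℕ → List ℕ
indicator k = List.replicate k 0 List.++ 1 ∷ []

nth-indicator-≡ : ∀ k → nth 0 (indicator k) k ≡ 1
nth-indicator-≡ zero    = refl
nth-indicator-≡ (suc k) = nth-indicator-≡ k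

nth-indicator-≢ : ∀ {i k} → i ≢ k → nth 0 (indicator k) i ≡ 0
nth-indicator-≢ {zero}  {zero}  i≢k = contradiction refl i≢k
nth-indicator-≢ {suc i} {zero}  i≢k = refl
nth-indicator-≢ {zero}  {suc k} i≢k = refl
nth-indicator-≢ {suc i} {suc k} i≢k = nth-indicator-≢ λ eq → i≢k (cong suc eq)

hasWeight : ℕ → ℕ → ℤ
hasWeight k i = + nth 0 (indicator k) i

-- The list of `d` ones is the indicator of the weights below `d`; beyond its end `nth` returns 0.
nth-replicate : ∀ d i → nth 0 (List.replicate d 1) i ≡ 0 → d ≤ i
nth-replicate zero    i       _  = z≤n
nth-replicate (suc d) (suc i) eq = s≤s (nth-replicate d i eq)

-- Counting combinations of few rows

-- The counts are evaluated by the type checker, which is several times faster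
-- on this unindexed type than on Vec Bool n.
data Bits : Set where
  ε   : Bits
  O I : Bits → Bits

toBits : Word n → Bits
toBits []          = ε
toBits (false ∷ x) = O (toBits x)
toBits (true ∷ x)  = I (toBits x)

rowBits : Vec (Word n) k → List Bits
rowBits []      = []
rowBits (r ∷ M) = toBits r ∷ rowBits M

infixl 6 _⊞_
_⊞_ : Bits → Bits → Bits
O x ⊞ O y = O (x ⊞ y)
O x ⊞ I y = I (x ⊞ y)
I x ⊞ O y = I (x ⊞ y)
I x ⊞ I y = O (x ⊞ y)
_   ⊞ _   = ε

toBits-⊕ : (x y : Word n) → toBits (x ⊕ y) ≡ toBits x ⊞ toBits y
toBits-⊕ []          []          = refl
toBits-⊕ (false ∷ x) (false ∷ y) = cong O (toBits-⊕ x y)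
toBits-⊕ (false ∷ x) (true ∷ y)  = cong I (toBits-⊕ x y)
toBits-⊕ (true ∷ x)  (false ∷ y) = cong I (toBits-⊕ x y)
toBits-⊕ (true ∷ x)  (true ∷ y)  = cong O (toBits-⊕ x y)

-- The ones of the word use up `l`, so the traversal stops as soon as the word is too heavy for the
-- support of `l`; this keeps the counts cheap.
weigh : List ℕ → Bits → ℕ
weigh []        _     = 0
weigh (v ∷ _)   ε     = v
weigh l@(_ ∷ _) (O x) = weigh l x
weigh (_ ∷ l)   (I x) = weigh l x

weigh-toBits : (l : List ℕ) (x : Word n) → weigh l (toBits x) ≡ nth 0 l (wt x)
weigh-toBits []      x           = refl
weigh-toBits (v ∷ l) []          = refl
weigh-toBits (v ∷ l) (false ∷ x) = weigh-toBits (v ∷ l) x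
weigh-toBits (v ∷ l) (true ∷ x)  = weigh-toBits l x

weigh-⊞ : List ℕ → Bits → Bits → ℕ
weigh-⊞ []        _     _     = 0
weigh-⊞ l@(_ ∷ _) (O x) (O y) = weigh-⊞ l x y
weigh-⊞ (_ ∷ l)   (O x) (I y) = weigh-⊞ l x y
weigh-⊞ (_ ∷ l)   (I x) (O y) = weigh-⊞ l x y
weigh-⊞ l@(_ ∷ _) (I x) (I y) = weigh-⊞ l x y
weigh-⊞ (v ∷ _)   _     _     = v

weigh-⊞-≡ : ∀ l x y → weigh-⊞ l x y ≡ weigh l (x ⊞ y)
weigh-⊞-≡ []      x     y     = refl
weigh-⊞-≡ (v ∷ l) (O x) (O y) = weigh-⊞-≡ (v ∷ l) x y
weigh-⊞-≡ (v ∷ l) (O x) (I y) = weigh-⊞-≡ l x y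
weigh-⊞-≡ (v ∷ l) (I x) (O y) = weigh-⊞-≡ l x y
weigh-⊞-≡ (v ∷ l) (I x) (I y) = weigh-⊞-≡ (v ∷ l) x y
weigh-⊞-≡ (v ∷ l) ε     y     = refl
weigh-⊞-≡ (v ∷ l) (O x) ε     = refl
weigh-⊞-≡ (v ∷ l) (I x) ε     = refl

tail : List ℕ → List ℕ
tail []      = []
tail (_ ∷ l) = l

nth-tail : ∀ l i → nth 0 l (suc i) ≡ nth 0 (tail l) i
nth-tail []      i = refl
nth-tail (_ ∷ l) i = refl

-- The clause for a single remaining row avoids building the sum s ⊞ r.
sweep : ℕ → List ℕ → List Bits → Bits → ℕ
sweep zero          l M       s = weigh l s
sweep (suc j)       l []      s = weigh l s
sweep (suc zero)    l (r ∷ M) s = sweep (suc zero) l M s ℕ.+ weigh-⊞ (tail l) s r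
sweep (suc (suc j)) l (r ∷ M) s = sweep (suc (suc j)) l M s ℕ.+ sweep (suc j) (tail l) M (s ⊞ r)

sweep-∷ : ∀ j l r M s → sweep (suc j) l (r ∷ M) s ≡ sweep (suc j) l M s ℕ.+ sweep j (tail l) M (s ⊞ r)
sweep-∷ zero    l r M s = cong (λ v → sweep 1 l M s ℕ.+ v) (weigh-⊞-≡ (tail l) s r)
sweep-∷ (suc j) l r M s = refl

sweep-∷-⊕ : ∀ j l (r : Word n) (M : Vec (Word n) k) s →
  sweep (suc j) l (rowBits (r ∷ M)) (toBits s)
    ≡ sweep (suc j) l (rowBits M) (toBits s) ℕ.+ sweep j (tail l) (rowBits M) (toBits (s ⊕ r))
sweep-∷-⊕ j l r M s = trans (sweep-∷ j l (toBits r) (rowBits M) (toBits s))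
  (cong (λ x → sweep (suc j) l (rowBits M) (toBits s) ℕ.+ sweep j (tail l) (rowBits M) x) (sym (toBits-⊕ s r)))

ifLight : ℕ → ℕ → ℤ → ℤ
ifLight j i v = if i ≤ᵇ j then v else 0ℤ

≤ᵇ-suc : ∀ i j → (i <ᵇ suc j) ≡ (i ≤ᵇ j)
≤ᵇ-suc zero    j = refl
≤ᵇ-suc (suc i) j = refl

weigh-⊕𝟎 : ∀ l (s : Word n) → weigh l (toBits s) ≡ nth 0 l (wt (s ⊕ 𝟎))
weigh-⊕𝟎 l s = trans (weigh-toBits l s) (cong (λ x → nth 0 l (wt x)) (sym (⊕-identityʳ s)))

skipRow : (s : Word n) (a : Word k) (r : Word n) (M : Vec (Word n) k) →
  s ⊕ linComb a M ≡ s ⊕ linComb (false ∷ a) (r ∷ M)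
skipRow s a r M = cong (s ⊕_) (sym (linComb-false a r M))

takeRow : (s : Word n) (a : Word k) (r : Word n) (M : Vec (Word n) k) →
  (s ⊕ r) ⊕ linComb a M ≡ s ⊕ linComb (true ∷ a) (r ∷ M)
takeRow s a r M = trans (⊕-assoc s r _) (cong (s ⊕_) (sym (linComb-true a r M)))

-- The recursion decides for each row whether it is used. A used row lowers the budget `j` and
-- replaces `l` by its `tail`, which accounts for the 1 that it adds to `wt a`.
sweep-∑ : ∀ j l (M : Vec (Word n) k) (s : Word n) →
  + sweep j l (rowBits M) (toBits s)
    ≡ ∑ λ a → ifLight j (wt a) (+ nth 0 l (wt a ℕ.+ wt (s ⊕ linComb a M)))
sweep-∑ zero    l []      s = cong +_ (weigh-⊕𝟎 l s)
sweep-∑ (suc j) l []      s = cong +_ (weigh-⊕𝟎 l s)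
sweep-∑ {k = suc k} zero l (r ∷ M) s = begin
  + weigh l (toBits s)
    ≡⟨ sweep-∑ zero l M s ⟩
  ∑ (λ a → ifLight 0 (wt a) (+ nth 0 l (wt a ℕ.+ wt (s ⊕ linComb a M))))
    ≡⟨ ∑-cong (λ a → cong (λ x → ifLight 0 (wt a) (+ nth 0 l (wt a ℕ.+ wt x))) (skipRow s a r M)) ⟩
  skipped
    ≡⟨ ℤ.+-identityʳ skipped ⟨
  skipped + 0ℤ
    ≡⟨ cong (λ t → skipped + t) (∑-0 {k}) ⟨
  skipped + ∑ {k} (λ _ → 0ℤ) ∎
  where
  skipped = ∑ λ a → ifLight 0 (wt a) (+ nth 0 l (wt a ℕ.+ wt (s ⊕ linComb (false ∷ a) (r ∷ M))))
sweep-∑ (suc j) l (r ∷ M) s = trans (cong +_ (sweep-∷-⊕ j l r M s)) (cong₂ _+_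
  (trans (sweep-∑ (suc j) l M s)
    (∑-cong λ a → cong (λ x → ifLight (suc j) (wt a) (+ nth 0 l (wt a ℕ.+ wt x))) (skipRow s a r M)))
  (trans (sweep-∑ j (tail l) M (s ⊕ r)) (∑-cong λ a → cong₂ (λ b t → if b then + t else 0ℤ)
    (sym (≤ᵇ-suc (wt a) j))
    (trans (sym (nth-tail l _)) (cong (λ x → nth 0 l (suc (wt a ℕ.+ wt x))) (takeRow s a r M))))))

-- The values are natural numbers: a vanishing total cannot come from cancellation.
sweep≡0 : ∀ j l (M : Vec (Word n) k) (s : Word n) → sweep j l (rowBits M) (toBits s) ≡ 0 →
  ∀ a → wt a ≤ j → nth 0 l (wt a ℕ.+ wt (s ⊕ linComb a M)) ≡ 0
sweep≡0 zero    l []      s eq []          _ = trans (sym (weigh-⊕𝟎 l s)) eq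
sweep≡0 (suc j) l []      s eq []          _ = trans (sym (weigh-⊕𝟎 l s)) eq
sweep≡0 zero    l (r ∷ M) s eq (false ∷ a) h =
  trans (cong (λ x → nth 0 l (wt a ℕ.+ wt x)) (sym (skipRow s a r M))) (sweep≡0 zero l M s eq a h)
sweep≡0 (suc j) l (r ∷ M) s eq (false ∷ a) h =
  trans (cong (λ x → nth 0 l (wt a ℕ.+ wt x)) (sym (skipRow s a r M)))
    (sweep≡0 (suc j) l M s (ℕ.m+n≡0⇒m≡0 _ (trans (sym (sweep-∷-⊕ j l r M s)) eq)) a h)
sweep≡0 (suc j) l (r ∷ M) s eq (true ∷ a)  (s≤s h) = begin
  nth 0 l (suc (wt a ℕ.+ wt (s ⊕ linComb (true ∷ a) (r ∷ M))))  ≡⟨ nth-tail l _ ⟩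
  nth 0 (tail l) (wt a ℕ.+ wt (s ⊕ linComb (true ∷ a) (r ∷ M))) ≡⟨ cong (λ x → nth 0 (tail l) (wt a ℕ.+ wt x)) (takeRow s a r M) ⟨
  nth 0 (tail l) (wt a ℕ.+ wt ((s ⊕ r) ⊕ linComb a M))          ≡⟨ sweep≡0 j (tail l) M (s ⊕ r) taken a h ⟩
  0                                                             ∎
  where
  taken = ℕ.m+n≡0⇒n≡0 (sweep (suc j) l (rowBits M) (toBits s)) (trans (sym (sweep-∷-⊕ j l r M s)) eq)

-- Combinations are sorted by the first row that they use. This leaves out the empty one, whose sum
-- `𝟎` is light.
lightWords : ℕ → ℕ → List Bits → ℕ
lightWords d _       []      = 0
lightWords d zero    (r ∷ M) = 0
-- The first row used adds 1 to the weight of the coefficient vector, so the indicator of the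
-- weights below `d` catches total weights up to `d`.
lightWords d (suc j) (r ∷ M) = lightWords d (suc j) M ℕ.+ sweep j (List.replicate d 1) M r

wt≡0⇒𝟎 : (a : Word n) → wt a ≤ 0 → a ≡ 𝟎
wt≡0⇒𝟎 []          _ = refl
wt≡0⇒𝟎 (false ∷ a) h = cong (false ∷_) (wt≡0⇒𝟎 a h)

lightWords≡0 : ∀ d j (M : Vec (Word n) k) → lightWords d j (rowBits M) ≡ 0 →
  ∀ {a} → a ≢ 𝟎 → wt a ≤ j → d < wt a ℕ.+ wt (linComb a M)
lightWords≡0 d j       []      eq {[]}        a≢𝟎 _ = contradiction refl a≢𝟎
lightWords≡0 d zero    (r ∷ M) eq {a}         a≢𝟎 h = contradiction (wt≡0⇒𝟎 a h) a≢𝟎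
lightWords≡0 d (suc j) (r ∷ M) eq {false ∷ a} a≢𝟎 h =
  subst (λ x → d < wt a ℕ.+ wt x) (sym (linComb-false a r M))
    (lightWords≡0 d (suc j) M (ℕ.m+n≡0⇒m≡0 _ eq) (λ a≡𝟎 → a≢𝟎 (cong (false ∷_) a≡𝟎)) h)
lightWords≡0 d (suc j) (r ∷ M) eq {true ∷ a}  a≢𝟎 (s≤s h) =
  s≤s (nth-replicate d _ (trans (cong (λ x → nth 0 (List.replicate d 1) (wt a ℕ.+ wt x)) (linComb-true a r M))
    (sweep≡0 j (List.replicate d 1) M r (ℕ.m+n≡0⇒n≡0 (lightWords d (suc j) (rowBits M)) eq) a h)))

-- Parity

odd : ℕ → Bool
odd zero    = false
odd (suc n) = not (odd n)

odd-+ : ∀ i j → odd (i ℕ.+ j) ≡ odd i xor odd j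
odd-+ zero    j = refl
odd-+ (suc i) j = trans (cong not (odd-+ i j)) (Bool.not-distribˡ-xor (odd i) (odd j))

odd-wt : (x : Word n) → foldr′ _xor_ false x ≡ odd (wt x)
odd-wt []          = refl
odd-wt (false ∷ x) = odd-wt x
odd-wt (true ∷ x)  = cong not (odd-wt x)

wt-⊕ : (x y : Word n) → let o = wt (zipWith _∧_ x y) in wt (x ⊕ y) ℕ.+ (o ℕ.+ o) ≡ wt x ℕ.+ wt y
wt-⊕ []          []          = refl
wt-⊕ (false ∷ x) (false ∷ y) = wt-⊕ x y
wt-⊕ (false ∷ x) (true ∷ y)  = trans (cong suc (wt-⊕ x y)) (sym (ℕ.+-suc (wt x) (wt y)))
wt-⊕ (true ∷ x)  (false ∷ y) = cong suc (wt-⊕ x y)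
wt-⊕ (true ∷ x)  (true ∷ y)  = begin
  wt (x ⊕ y) ℕ.+ suc (o ℕ.+ suc o)     ≡⟨ ℕ.+-suc (wt (x ⊕ y)) _ ⟩
  suc (wt (x ⊕ y) ℕ.+ (o ℕ.+ suc o))   ≡⟨ cong (λ t → suc (wt (x ⊕ y) ℕ.+ t)) (ℕ.+-suc o o) ⟩
  suc (wt (x ⊕ y) ℕ.+ suc (o ℕ.+ o))   ≡⟨ cong suc (ℕ.+-suc (wt (x ⊕ y)) _) ⟩
  suc (suc (wt (x ⊕ y) ℕ.+ (o ℕ.+ o))) ≡⟨ cong (λ t → suc (suc t)) (wt-⊕ x y) ⟩
  suc (suc (wt x ℕ.+ wt y))            ≡⟨ cong suc (ℕ.+-suc (wt x) (wt y)) ⟨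
  suc (wt x ℕ.+ suc (wt y))            ∎
  where o = wt (zipWith _∧_ x y)

halve : ∀ w o s → w ℕ.+ (o ℕ.+ o) ≡ s ℕ.+ s → ∃ λ r → w ≡ r ℕ.+ r × r ℕ.+ o ≡ s
halve w zero    s       eq = s , trans (sym (ℕ.+-identityʳ w)) eq , ℕ.+-identityʳ s
halve w (suc o) zero    eq = contradiction (trans (sym (ℕ.+-suc w _)) eq) λ ()
halve w (suc o) (suc s) eq =
  let r , w≡r+r , r+o≡s = halve w o s (ℕ.suc-injective (ℕ.suc-injective (begin
        suc (suc (w ℕ.+ (o ℕ.+ o)))   ≡⟨ cong suc (ℕ.+-suc w _) ⟨
        suc (w ℕ.+ suc (o ℕ.+ o))     ≡⟨ ℕ.+-suc w _ ⟨
        w ℕ.+ suc (suc (o ℕ.+ o))     ≡⟨ cong (λ t → w ℕ.+ suc t) (ℕ.+-suc o o) ⟨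
        w ℕ.+ (suc o ℕ.+ suc o)       ≡⟨ eq ⟩
        suc s ℕ.+ suc s               ≡⟨ cong suc (ℕ.+-suc s s) ⟩
        suc (suc (s ℕ.+ s))           ∎)))
  in r , w≡r+r , trans (ℕ.+-suc r o) (cong suc r+o≡s)

even⇒double : ∀ i → odd i ≡ false → i ≡ ⌊ i /2⌋ ℕ.+ ⌊ i /2⌋
even⇒double zero          _  = refl
even⇒double (suc (suc i)) eq = cong suc (trans
  (cong suc (even⇒double i (trans (sym (Bool.not-involutive _)) eq))) (sym (ℕ.+-suc ⌊ i /2⌋ ⌊ i /2⌋)))

Halved : Word n → Word n → Set
Halved u x = ∃ λ p → wt x ≡ p ℕ.+ p × odd p ≡ ⟨ x , u ⟩

-- Half of wt (x ⊕ y) is half of wt x plus half of wt y minus the overlap of x and y, and the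
-- overlap is even since x ⊥ y. Hence half the weight modulo 2 is additive on a self-orthogonal
-- code.
Halved-⊕ : (u x y : Word n) → ⟨ x , y ⟩ ≡ false → Halved u x → Halved u y → Halved u (x ⊕ y)
Halved-⊕ u x y x⊥y (p , wx , px) (q , wy , qy) =
  let r , w≡r+r , r+o≡s = halve (wt (x ⊕ y)) o (p ℕ.+ q) double in
  r , w≡r+r , (begin
    odd r                         ≡⟨ Bool.xor-identityʳ (odd r) ⟨
    odd r xor false               ≡⟨ cong (odd r xor_) x⊥y ⟨
    odd r xor ⟨ x , y ⟩           ≡⟨ cong (odd r xor_) (odd-wt (zipWith _∧_ x y)) ⟩
    odd r xor odd o               ≡⟨ odd-+ r o ⟨
    odd (r ℕ.+ o)                 ≡⟨ cong odd r+o≡s ⟩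
    odd (p ℕ.+ q)                 ≡⟨ odd-+ p q ⟩
    odd p xor odd q               ≡⟨ cong₂ _xor_ px qy ⟩
    ⟨ x , u ⟩ xor ⟨ y , u ⟩       ≡⟨ ⟨⟩-⊕ˡ x y u ⟨
    ⟨ x ⊕ y , u ⟩                 ∎)
  where
  o = wt (zipWith _∧_ x y)
  double : wt (x ⊕ y) ℕ.+ (o ℕ.+ o) ≡ (p ℕ.+ q) ℕ.+ (p ℕ.+ q)
  double = begin
    wt (x ⊕ y) ℕ.+ (o ℕ.+ o)      ≡⟨ wt-⊕ x y ⟩
    wt x ℕ.+ wt y                 ≡⟨ cong₂ ℕ._+_ wx wy ⟩
    (p ℕ.+ p) ℕ.+ (q ℕ.+ q)       ≡⟨ ℕ-interchange p p q q ⟩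
    (p ℕ.+ q) ℕ.+ (p ℕ.+ q)       ∎

-- Listing words

words : ∀ n → List (Word n)
words zero    = [] ∷ []
words (suc n) = List.map (false ∷_) (words n) List.++ List.map (true ∷_) (words n)

∈-words : (x : Word n) → x List.∈ words n
∈-words []          = here refl
∈-words (false ∷ x) = ∈-++⁺ˡ (∈-map⁺ (false ∷_) (∈-words x))
∈-words {suc n} (true ∷ x) = ∈-++⁺ʳ (List.map (false ∷_) (words n)) (∈-map⁺ (true ∷_) (∈-words x))

words-unique : ∀ n → Unique (words n)
words-unique zero    = [] ∷ []
words-unique (suc n) = Unique.++⁺
  (Unique.map⁺ ∷-injectiveʳ (words-unique n)) (Unique.map⁺ ∷-injectiveʳ (words-unique n))
  λ (x∈false , x∈true) →
    let _ , _ , x≡false = ∈-map⁻ (false ∷_) x∈false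
        _ , _ , x≡true  = ∈-map⁻ (true ∷_) x∈true
    in contradiction (∷-injectiveˡ (trans (sym x≡false) x≡true)) λ ()

-- `g` is arbitrary so that the induction can absorb the leading bit of each half of `words` into
-- it.
length-filter-words : {B : Set} {P : B → Set} (P? : Decidable P) (g : Word n → B) →
  + length (filter P? (List.map g (words n))) ≡ ∑ λ a → + (if does (P? (g a)) then 1 else 0)
length-filter-words {zero} P? g with does (P? (g []))
... | true  = refl
... | false = refl
length-filter-words {suc n} P? g = begin
  + length (filter P? (List.map g (words (suc n))))
    ≡⟨ cong (λ l → + length (filter P? l)) (List.map-++ g (List.map (false ∷_) (words n)) (List.map (true ∷_) (words n))) ⟩
  + length (filter P? (List.map g (List.map (false ∷_) (words n)) List.++ List.map g (List.map (true ∷_) (words n))))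
    ≡⟨ cong₂ (λ l l′ → + length (filter P? (l List.++ l′))) (List.map-∘ (words n)) (List.map-∘ (words n)) ⟨
  + length (filter P? (g₀ List.++ g₁))
    ≡⟨ cong (λ l → + length l) (List.filter-++ P? g₀ g₁) ⟩
  + length (filter P? g₀ List.++ filter P? g₁)
    ≡⟨ cong +_ (List.length-++ (filter P? g₀)) ⟩
  + length (filter P? g₀) + + length (filter P? g₁)
    ≡⟨ cong₂ _+_ (length-filter-words P? λ a → g (false ∷ a)) (length-filter-words P? λ a → g (true ∷ a)) ⟩
  _ ∎
  where
  g₀ = List.map (λ a → g (false ∷ a)) (words n)
  g₁ = List.map (λ a → g (true ∷ a)) (words n)

hasWeight-does : ∀ k i → hasWeight k i ≡ + (if does (i ℕ.≟ k) then 1 else 0)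
hasWeight-does k i with i ℕ.≟ k
... | yes refl = cong +_ (trans (nth-indicator-≡ i)
  (cong (λ b → if b then 1 else 0) (sym (dec-true (i ℕ.≟ i) refl))))
... | no  i≢k  = cong +_ (trans (nth-indicator-≢ i≢k)
  (cong (λ b → if b then 1 else 0) (sym (dec-false (i ℕ.≟ k) i≢k))))

-- The witness is the filtered list of all codewords. Its length comes from the symbolic sum, and
-- injectivity of `g` excludes repetitions.
span-size : (g : Word k → Word n) → (∀ {a b} → g a ≡ g b → a ≡ b) →
  ∀ i N → ∑ (λ a → hasWeight i (wt (g a))) ≡ + N → A (λ x → ∃ λ a → g a ≡ x) i N
span-size {k} g g-injective i N total =
  xs , Unique.filter⁺ P? (Unique.map⁺ g-injective (words-unique k)) , ℤ.+-injective (begin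
    + length xs                                     ≡⟨ length-filter-words P? g ⟩
    ∑ (λ a → + (if does (P? (g a)) then 1 else 0))  ≡⟨ ∑-cong (λ a → hasWeight-does i (wt (g a))) ⟨
    ∑ (λ a → hasWeight i (wt (g a)))                ≡⟨ total ⟩
    + N                                             ∎) ,
  λ x → mk⇔
    (λ { ((a , refl) , wt≡i) → ∈-filter⁺ P? (∈-map⁺ g (∈-words a)) wt≡i })
    (λ x∈xs → let x∈map , wt≡i = ∈-filter⁻ P? {xs = List.map g (words k)} x∈xs
                  a , _ , x≡ga = ∈-map⁻ g x∈map
              in (a , sym x≡ga) , wt≡i)
  where
  P? : Decidable (λ x → wt x ≡ i)
  P? x = wt x ℕ.≟ i
  xs = filter P? (List.map g (words k))

-- The systematic code with generator matrix (𝟏 | R)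

encode : Vec (Word n) k → Word k → Word (k ℕ.+ n)
encode R a = a ++ linComb a R

-- halfWeights R ++ 𝟎 lies in the shadow: its product with a codeword c is wt c / 2 mod 2.
halfWeights : Vec (Word n) k → Word k
halfWeights R = map (λ r → odd ⌊ suc (wt r) /2⌋) R

HalvedRow : Vec (Word n) k → Word k → Set
HalvedRow R e = odd (wt c) ≡ false × odd ⌊ wt c /2⌋ ≡ ⟨ c , halfWeights R ++ 𝟎 ⟩
  where c = encode R e

-- Exactly one half of a vector of weight 2m+1 has weight at most m.
shadowCount : Vec (Word n) n → ℕ → ℕ
shadowCount R m = sweep m l (rowBits R) (toBits (linComb h R)) ℕ.+ sweep m l (rowBits (transpose R)) (toBits h)
  where
  h = halfWeights R
  l = indicator (suc (m ℕ.+ m))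

record Certificate (R : Vec (Word n) n) (b₁ b₅ b₉ : ℕ) : Set where
  field
    RRᵀ≡𝟏   : map (λ r → linComb r (transpose R)) R ≡ 𝟏 n
    RᵀR≡𝟏   : map (λ c → linComb c R) (transpose R) ≡ 𝟏 n
    rows    : Vec.All (HalvedRow R) (𝟏 n)
    lightˡ  : lightWords 10 5 (rowBits R) ≡ 0
    lightʳ  : lightWords 10 4 (rowBits (transpose R)) ≡ 0
    -- The arguments 0, 2, 4 are the m with 2m + 1 = 1, 5, 9.
    shadow₁ : shadowCount R 0 ≡ b₁
    shadow₅ : shadowCount R 2 ≡ b₅
    shadow₉ : shadowCount R 4 ≡ b₉

certificate? : ∀ (R : Vec (Word n) n) b₁ b₅ b₉ → Dec (Certificate R b₁ b₅ b₉)
certificate? R b₁ b₅ b₉ = map′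
  (λ (RRᵀ , RᵀR , rows , lˡ , lʳ , s₁ , s₅ , s₉) → record
    { RRᵀ≡𝟏 = RRᵀ ; RᵀR≡𝟏 = RᵀR ; rows = rows ; lightˡ = lˡ ; lightʳ = lʳ
    ; shadow₁ = s₁ ; shadow₅ = s₅ ; shadow₉ = s₉ })
  (λ c → let open Certificate c in RRᵀ≡𝟏 , RᵀR≡𝟏 , rows , lightˡ , lightʳ , shadow₁ , shadow₅ , shadow₉)
  ((_ ≟ᴹ _) ×-dec (_ ≟ᴹ _) ×-dec Vec.all? (λ _ → (_ Bool.≟ _) ×-dec (_ Bool.≟ _)) _ ×-dec
    (_ ℕ.≟ _) ×-dec (_ ℕ.≟ _) ×-dec (_ ℕ.≟ _) ×-dec (_ ℕ.≟ _) ×-dec (_ ℕ.≟ _))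
  where
  _≟ᴹ_ : (M N : Vec (Word m) k) → Dec (M ≡ N)
  _≟ᴹ_ = ≡-dec (≡-dec Bool._≟_)

linComb-inverse : (M : Vec (Word n) k) (N : Vec (Word k) n) →
  map (λ r → linComb r N) M ≡ 𝟏 k → ∀ a → linComb (linComb a M) N ≡ a
linComb-inverse {k = k} M N MN≡𝟏 a = begin
  linComb (linComb a M) N               ≡⟨ linComb-linComb a M N ⟨
  linComb a (map (λ r → linComb r N) M) ≡⟨ cong (linComb a) MN≡𝟏 ⟩
  linComb a (𝟏 k)                       ≡⟨ linComb-𝟏 a ⟩
  a                                     ∎

linComb-closed : (P : Word n → Set) → P 𝟎 → (∀ x y → P x → P y → P (x ⊕ y)) →
  {M : Vec (Word n) k} → Vec.All P M → ∀ a → P (linComb a M)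
linComb-closed P P𝟎 P⊕ Vec.[]                   []          = P𝟎
linComb-closed P P𝟎 P⊕ (Vec._∷_ {x = r} {xs = M} p ps) (false ∷ a) =
  subst P (sym (linComb-false a r M)) (linComb-closed P P𝟎 P⊕ ps a)
linComb-closed P P𝟎 P⊕ (Vec._∷_ {x = r} {xs = M} p ps) (true ∷ a) =
  subst P (sym (linComb-true a r M)) (P⊕ r _ p (linComb-closed P P𝟎 P⊕ ps a))

wt-𝟎 : wt (𝟎 {n}) ≡ 0
wt-𝟎 {zero}  = refl
wt-𝟎 {suc n} = wt-𝟎 {n}

_≟𝟎 : (x : Word n) → Dec (x ≡ 𝟎)
x ≟𝟎 = ≡-dec Bool._≟_ x 𝟎

ifLight-0 : ∀ m i {v} → v ≡ 0ℤ → ifLight m i v ≡ 0ℤ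
ifLight-0 m i refl with i ≤ᵇ m
... | true  = refl
... | false = refl

ifLight-≤ : ∀ {m i} v → i ≤ m → ifLight m i v ≡ v
ifLight-≤ {m} {i} v i≤m = cong (λ b → if b then v else 0ℤ) (dec-true (i ℕ.≤? m) i≤m)

ifLight-> : ∀ {m i} v → m < i → ifLight m i v ≡ 0ℤ
ifLight-> {m} {i} v m<i = cong (λ b → if b then v else 0ℤ) (dec-false (i ℕ.≤? m) (ℕ.<⇒≱ m<i))

split-odd : ∀ m i j → let v = hasWeight (suc (m ℕ.+ m)) (i ℕ.+ j) in v ≡ ifLight m i v + ifLight m j v
split-odd m i j with i ℕ.+ j ℕ.≟ suc (m ℕ.+ m)
... | no  i+j≢ = trans v≡0 (sym (cong₂ _+_ (ifLight-0 m i v≡0) (ifLight-0 m j v≡0)))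
  where v≡0 = cong +_ (nth-indicator-≢ i+j≢)
... | yes i+j≡ with i ℕ.≤? m
...   | yes i≤m = sym (trans (cong₂ _+_ (ifLight-≤ _ i≤m) (ifLight-> _ m<j)) (ℤ.+-identityʳ _))
  where
  m<j : m < j
  m<j = ℕ.≰⇒> λ j≤m → ℕ.<-irrefl i+j≡ (s≤s (ℕ.+-mono-≤ i≤m j≤m))
...   | no  i≰m = sym (trans (cong₂ _+_ (ifLight-> _ (ℕ.≰⇒> i≰m)) (ifLight-≤ _ j≤m)) (ℤ.+-identityˡ _))
  where
  j≤m : j ≤ m
  j≤m = ℕ.≮⇒≥ λ m<j → ℕ.<-irrefl (sym i+j≡) (ℕ.≤-trans (s≤s (ℕ.≤-reflexive (sym (ℕ.+-suc m m)))) (ℕ.+-mono-≤ (ℕ.≰⇒> i≰m) m<j))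

-- Self-duality, the MacWilliams identity and the shadow

module Code (R : Vec (Word n) n)
  (RRᵀ≡𝟏 : map (λ r → linComb r (transpose R)) R ≡ 𝟏 n)
  (RᵀR≡𝟏 : map (λ c → linComb c R) (transpose R) ≡ 𝟏 n)
  where

  RRᵀ : ∀ a → linComb (linComb a R) (transpose R) ≡ a
  RRᵀ = linComb-inverse R (transpose R) RRᵀ≡𝟏

  RᵀR : ∀ b → linComb (linComb b (transpose R)) R ≡ b
  RᵀR = linComb-inverse (transpose R) R RᵀR≡𝟏

  Rᵀ : Vec (Word n) n
  Rᵀ = transpose R

  encode-⊕ : ∀ a b → encode R (a ⊕ b) ≡ encode R a ⊕ encode R b
  encode-⊕ a b = trans (cong (a ⊕ b ++_) (linComb-⊕ a b R)) (sym (++-⊕ a b (linComb a R) (linComb b R)))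

  -- By adjointness, `p ⊕ linComb q Rᵀ` is the syndrome of `p ++ q`: it vanishes exactly when the
  -- word is orthogonal to the code.
  ⟨encode,⟩ : ∀ a p q → ⟨ encode R a , p ++ q ⟩ ≡ ⟨ a , p ⊕ linComb q Rᵀ ⟩
  ⟨encode,⟩ a p q = begin
    ⟨ encode R a , p ++ q ⟩                 ≡⟨ ⟨⟩-++ a p (linComb a R) q ⟩
    ⟨ a , p ⟩ xor ⟨ linComb a R , q ⟩       ≡⟨ cong (⟨ a , p ⟩ xor_) (⟨linComb,⟩-transpose a R q) ⟩
    ⟨ a , p ⟩ xor ⟨ a , linComb q Rᵀ ⟩      ≡⟨ ⟨⟩-⊕ʳ a p (linComb q Rᵀ) ⟨
    ⟨ a , p ⊕ linComb q Rᵀ ⟩                ∎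

  -- R and Rᵀ are inverse, so p = q Rᵀ forces q = p R. The first condition describes the dual code,
  -- the second the code itself.
  left⇒right : ∀ p q → p ⊕ linComb q Rᵀ ≡ 𝟎 → q ⊕ linComb p R ≡ 𝟎
  left⇒right p q eq = begin
    q ⊕ linComb p R                 ≡⟨ cong (λ r → q ⊕ linComb r R) (⊕≡𝟎⇒≡ p _ eq) ⟩
    q ⊕ linComb (linComb q Rᵀ) R    ≡⟨ cong (q ⊕_) (RᵀR q) ⟩
    q ⊕ q                           ≡⟨ ⊕-self q ⟩
    𝟎                               ∎

  right⇒left : ∀ p q → q ⊕ linComb p R ≡ 𝟎 → p ⊕ linComb q Rᵀ ≡ 𝟎
  right⇒left p q eq = begin
    p ⊕ linComb q Rᵀ                ≡⟨ cong (λ r → p ⊕ linComb r Rᵀ) (⊕≡𝟎⇒≡ q _ eq) ⟩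
    p ⊕ linComb (linComb p R) Rᵀ    ≡⟨ cong (p ⊕_) (RRᵀ p) ⟩
    p ⊕ p                           ≡⟨ ⊕-self p ⟩
    𝟎                               ∎

  ∑-dual : (f : Word n → Word n → ℤ) →
    ∑ (λ p → ∑ λ q → f p q * δ (p ⊕ linComb q Rᵀ)) ≡ ∑ (λ a → f a (linComb a R))
  ∑-dual f = ∑-cong λ p → trans
    (∑-cong λ q → cong (f p q *_) (δ-cong (left⇒right p q) (right⇒left p q)))
    (∑-δ (linComb p R) (f p))

  -- Both sides run over the codewords, parametrised once by the right half and once by the left
  -- half. The sum over all pairs (p, q), restricted by `δ`, mediates between them.
  ∑-transpose : (f : Word n → Word n → ℤ) → ∑ (λ b → f (linComb b Rᵀ) b) ≡ ∑ (λ a → f a (linComb a R))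
  ∑-transpose f = begin
    ∑ (λ b → f (linComb b Rᵀ) b)                      ≡⟨ ∑-cong (λ q → ∑-δ (linComb q Rᵀ) λ p → f p q) ⟨
    ∑ (λ q → ∑ λ p → f p q * δ (p ⊕ linComb q Rᵀ))    ≡⟨ ∑-comm (λ p q → f p q * δ (p ⊕ linComb q Rᵀ)) ⟨
    ∑ (λ p → ∑ λ q → f p q * δ (p ⊕ linComb q Rᵀ))    ≡⟨ ∑-dual f ⟩
    ∑ (λ a → f a (linComb a R))                       ∎

  -- Poisson summation. The transform is expanded into a sum over all words, whose translation by
  -- `u` absorbs the sign; after the exchange of sums, the character sum over the code is 2ⁿ times
  -- the indicator of the dual, which is the code. It serves for `u` = `𝟎` and for the shadow vector
  -- `halfWeights R ++ 𝟎`.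
  macWilliams : (u : Word (n ℕ.+ n)) (l : List ℤ) →
    ∑ (λ a → χ ⟨ encode R a , u ⟩ * krawtchouk (n ℕ.+ n) (wt (encode R a)) l)
      ≡ + (2 ℕ.^ n) * ∑ (λ a → nth 0ℤ l (wt (u ⊕ encode R a)))
  macWilliams u l = begin
    ∑ (λ a → χ ⟨ encode R a , u ⟩ * krawtchouk (n ℕ.+ n) (wt (encode R a)) l)
      ≡⟨ ∑-cong expand ⟩
    ∑ (λ a → ∑ λ y → F y * χ ⟨ encode R a , y ⟩)
      ≡⟨ ∑-comm (λ a y → F y * χ ⟨ encode R a , y ⟩) ⟩
    ∑ (λ y → ∑ λ a → F y * χ ⟨ encode R a , y ⟩)
      ≡⟨ ∑-cong (λ y → ∑-*ˡ (F y) λ a → χ ⟨ encode R a , y ⟩) ⟩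
    ∑ (λ y → F y * ∑ λ a → χ ⟨ encode R a , y ⟩)
      ≡⟨ ∑-++ {n} n (λ y → F y * ∑ λ a → χ ⟨ encode R a , y ⟩) ⟩
    ∑ {n} (λ p → ∑ {n} λ q → F (p ++ q) * ∑ λ a → χ ⟨ encode R a , p ++ q ⟩)
      ≡⟨ ∑-cong (λ p → ∑-cong λ q → characters p q) ⟩
    ∑ (λ p → ∑ λ q → N * F (p ++ q) * δ (p ⊕ linComb q Rᵀ))
      ≡⟨ ∑-dual (λ p q → N * F (p ++ q)) ⟩
    ∑ (λ a → N * F (encode R a))
      ≡⟨ ∑-*ˡ N (λ a → F (encode R a)) ⟩
    N * ∑ (λ a → F (encode R a)) ∎
    where
    N = + (2 ℕ.^ n)

    F : Word (n ℕ.+ n) → ℤ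
    F y = nth 0ℤ l (wt (u ⊕ y))

    expand : ∀ a → χ ⟨ encode R a , u ⟩ * krawtchouk (n ℕ.+ n) (wt (encode R a)) l ≡ ∑ λ y → F y * χ ⟨ encode R a , y ⟩
    expand a = begin
      χ ⟨ c , u ⟩ * krawtchouk (n ℕ.+ n) (wt c) l
        ≡⟨ cong (χ ⟨ c , u ⟩ *_) (∑-krawtchouk c l) ⟨
      χ ⟨ c , u ⟩ * ∑ (λ x → χ ⟨ x , c ⟩ * nth 0ℤ l (wt x))
        ≡⟨ ∑-*ˡ (χ ⟨ c , u ⟩) (λ x → χ ⟨ x , c ⟩ * nth 0ℤ l (wt x)) ⟨
      ∑ (λ x → χ ⟨ c , u ⟩ * (χ ⟨ x , c ⟩ * nth 0ℤ l (wt x)))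
        ≡⟨ ∑-cong shift ⟩
      ∑ (λ x → F (u ⊕ x) * χ ⟨ c , u ⊕ x ⟩)
        ≡⟨ ∑-⊕ u (λ y → F y * χ ⟨ c , y ⟩) ⟩
      ∑ (λ y → F y * χ ⟨ c , y ⟩) ∎
      where
      c = encode R a
      shift : ∀ x → χ ⟨ c , u ⟩ * (χ ⟨ x , c ⟩ * nth 0ℤ l (wt x)) ≡ F (u ⊕ x) * χ ⟨ c , u ⊕ x ⟩
      shift x = begin
        χ ⟨ c , u ⟩ * (χ ⟨ x , c ⟩ * nth 0ℤ l (wt x))   ≡⟨ *-rotate (χ ⟨ c , u ⟩) (χ ⟨ x , c ⟩) _ ⟩
        nth 0ℤ l (wt x) * (χ ⟨ c , u ⟩ * χ ⟨ x , c ⟩)   ≡⟨ cong (λ s → nth 0ℤ l (wt x) * (χ ⟨ c , u ⟩ * χ s)) (⟨⟩-comm x c) ⟩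
        nth 0ℤ l (wt x) * (χ ⟨ c , u ⟩ * χ ⟨ c , x ⟩)   ≡⟨ cong (nth 0ℤ l (wt x) *_) (χ-xor ⟨ c , u ⟩ ⟨ c , x ⟩) ⟨
        nth 0ℤ l (wt x) * χ (⟨ c , u ⟩ xor ⟨ c , x ⟩)   ≡⟨ cong₂ (λ z s → nth 0ℤ l (wt z) * χ s) (⊕-cancel u x) (⟨⟩-⊕ʳ c u x) ⟨
        F (u ⊕ x) * χ ⟨ c , u ⊕ x ⟩                  ∎

    characters : ∀ p q → F (p ++ q) * ∑ (λ a → χ ⟨ encode R a , p ++ q ⟩) ≡ N * F (p ++ q) * δ (p ⊕ linComb q Rᵀ)
    characters p q = begin
      F (p ++ q) * ∑ (λ a → χ ⟨ encode R a , p ++ q ⟩)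
        ≡⟨ cong (F (p ++ q) *_) (∑-cong λ a → cong χ (⟨encode,⟩ a p q)) ⟩
      F (p ++ q) * ∑ (λ a → χ ⟨ a , p ⊕ linComb q Rᵀ ⟩)
        ≡⟨ cong (F (p ++ q) *_) (∑-χ (p ⊕ linComb q Rᵀ)) ⟩
      F (p ++ q) * (N * δ (p ⊕ linComb q Rᵀ))
        ≡⟨ *-swapˡ (F (p ++ q)) N _ ⟩
      N * (F (p ++ q) * δ (p ⊕ linComb q Rᵀ))
        ≡⟨ ℤ.*-assoc N (F (p ++ q)) _ ⟨
      N * F (p ++ q) * δ (p ⊕ linComb q Rᵀ) ∎

  C : Pred (Word (n ℕ.+ n)) 0ℓ
  C x = ∃ λ a → encode R a ≡ x

  encode-𝟎 : encode R 𝟎 ≡ 𝟎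
  encode-𝟎 = trans (cong (𝟎 ++_) (linComb-𝟎 R)) (𝟎-++ n)

  encode-injective : ∀ {a b} → encode R a ≡ encode R b → a ≡ b
  encode-injective {a} {b} = ++-injectiveˡ a b

  encode-· : ∀ c a → encode R (c · a) ≡ c · encode R a
  encode-· true  a = trans (cong (encode R) (true-· a)) (sym (true-· (encode R a)))
  encode-· false a = trans (cong (encode R) (false-· a)) (trans encode-𝟎 (sym (false-· (encode R a))))

  isSubspace : IsSubspace C
  isSubspace = record
    { 𝟎-mem    = 𝟎 , encode-𝟎
    ; ⊕-closed = λ { (a , refl) (b , refl) → a ⊕ b , encode-⊕ a b }
    ; ·-closed = λ { c (a , refl) → c · a , encode-· c a }
    }

  generators : Vec (Word (n ℕ.+ n)) n
  generators = zipWith _++_ (𝟏 n) R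

  linComb-generators : ∀ a → linComb a generators ≡ encode R a
  linComb-generators a = trans (linComb-zipWith-++ a (𝟏 n) R) (cong (_++ linComb a R) (linComb-𝟏 a))

  dimension : HasDimension C n
  dimension = generators , record
    { members     = λ i → lookup (𝟏 n) i , (begin
        encode R (lookup (𝟏 n) i)                             ≡⟨ linComb-generators (lookup (𝟏 n) i) ⟨
        linComb (lookup (𝟏 n) i) generators                   ≡⟨ lookup-map i _ (𝟏 n) ⟨
        lookup (map (λ e → linComb e generators) (𝟏 n)) i     ≡⟨ cong (λ M → lookup M i) (𝟏-linComb generators) ⟩
        lookup generators i                                   ∎)
    ; independent = λ a eq → encode-injective (trans (sym (linComb-generators a)) (trans eq (sym encode-𝟎)))
    ; spanning    = λ { (a , refl) → a , linComb-generators a }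
    }

  selfOrthogonal : ∀ a b → ⟨ encode R a , encode R b ⟩ ≡ false
  selfOrthogonal a b = begin
    ⟨ encode R a , encode R b ⟩           ≡⟨ ⟨encode,⟩ a b (linComb b R) ⟩
    ⟨ a , b ⊕ linComb (linComb b R) Rᵀ ⟩  ≡⟨ cong (λ c → ⟨ a , b ⊕ c ⟩) (RRᵀ b) ⟩
    ⟨ a , b ⊕ b ⟩                         ≡⟨ cong ⟨ a ,_⟩ (⊕-self b) ⟩
    ⟨ a , 𝟎 ⟩                             ≡⟨ ⟨⟩-𝟎ʳ a ⟩
    false                                 ∎

  selfDual : SelfDual C
  selfDual = (λ { (a , refl) _ (b , refl) → selfOrthogonal a b }) , λ {x} → dual⊆C x
    where
    dual⊆C : ∀ x → dual C x → C x
    dual⊆C x x∈dual with splitAt n x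
    -- The syndrome pairs to `false` with every `a`, hence is `𝟎`.
    ... | p , q , refl = p , cong (p ++_) (sym (⊕≡𝟎⇒≡ q (linComb p R) (left⇒right p q (⟨⟩-nondegenerate _ λ a → begin
      ⟨ a , p ⊕ linComb q Rᵀ ⟩    ≡⟨ ⟨encode,⟩ a p q ⟨
      ⟨ encode R a , p ++ q ⟩     ≡⟨ ⟨⟩-comm (encode R a) (p ++ q) ⟩
      ⟨ p ++ q , encode R a ⟩     ≡⟨ x∈dual (encode R a) (a , refl) ⟩
      false                       ∎))))

  u : Word (n ℕ.+ n)
  u = halfWeights R ++ 𝟎

  -- Checking the generators is enough: half the weight modulo 2 is additive on the self-orthogonal
  -- code.
  encode-Halved : Vec.All (HalvedRow R) (𝟏 n) → ∀ a → Halved u (encode R a)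
  encode-Halved rows a = subst (λ b → Halved u (encode R b)) (linComb-𝟏 a)
    (linComb-closed (λ b → Halved u (encode R b))
      (0 , trans (cong wt encode-𝟎) (wt-𝟎 {n ℕ.+ n}) , sym (trans (cong ⟨_, u ⟩ encode-𝟎) (⟨⟩-𝟎ˡ u)))
      (λ x y hx hy → subst (Halved u) (sym (encode-⊕ x y)) (Halved-⊕ u (encode R x) (encode R y) (selfOrthogonal x y) hx hy))
      (Vec.map (λ {e} (even , half) → ⌊ wt (encode R e) /2⌋ , even⇒double _ even , half) rows) a)

  shadowWords : ℕ → ℤ
  shadowWords i = ∑ λ a → hasWeight i (wt (u ⊕ encode R a))

  -- A vector of the coset is `(h ⊕ a) ++ linComb a R`. If its left half is light, `h ⊕ a` becomes
  -- the summation variable and the sweep over the rows starts at `linComb h R`; if its right half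
  -- is light, that half becomes the variable and the sweep over the columns starts at `h`.
  shadowWords-odd : ∀ m → shadowWords (suc (m ℕ.+ m)) ≡ + shadowCount R m
  shadowWords-odd m = begin
    ∑ (λ a → hasWeight (suc (m ℕ.+ m)) (wt (u ⊕ encode R a)))
      ≡⟨ ∑-cong (λ a → trans (cong (hasWeight (suc (m ℕ.+ m))) (wt-coset a (linComb a R))) (split-odd m (wt (h ⊕ a)) (wt (linComb a R)))) ⟩
    ∑ (λ a → left a (linComb a R) + right a (linComb a R))
      ≡⟨ ∑-+ (λ a → left a (linComb a R)) (λ a → right a (linComb a R)) ⟩
    ∑ (λ a → left a (linComb a R)) + ∑ (λ a → right a (linComb a R))
      ≡⟨ cong₂ _+_ (trans (∑-cong left-shift) (∑-⊕ h leftSweep)) (trans (sym (∑-transpose right)) (∑-cong right-comm)) ⟩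
    ∑ leftSweep + ∑ rightSweep
      ≡⟨ cong₂ _+_ (sweep-∑ m l R (linComb h R)) (sweep-∑ m l Rᵀ h) ⟨
    + shadowCount R m ∎
    where
    h = halfWeights R
    l = indicator (suc (m ℕ.+ m))

    value : Word n → Word n → ℤ
    value p q = hasWeight (suc (m ℕ.+ m)) (wt (h ⊕ p) ℕ.+ wt q)

    left right : Word n → Word n → ℤ
    left  p q = ifLight m (wt (h ⊕ p)) (value p q)
    right p q = ifLight m (wt q) (value p q)

    leftSweep rightSweep : Word n → ℤ
    leftSweep  a = ifLight m (wt a) (hasWeight (suc (m ℕ.+ m)) (wt a ℕ.+ wt (linComb h R ⊕ linComb a R)))
    rightSweep b = ifLight m (wt b) (hasWeight (suc (m ℕ.+ m)) (wt b ℕ.+ wt (h ⊕ linComb b Rᵀ)))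

    wt-coset : ∀ p q → wt (u ⊕ (p ++ q)) ≡ wt (h ⊕ p) ℕ.+ wt q
    wt-coset p q = trans (cong wt (trans (++-⊕ h p 𝟎 q) (cong (h ⊕ p ++_) (⊕-identityˡ q)))) (wt-++ (h ⊕ p) q)

    left-shift : ∀ a → left a (linComb a R) ≡ leftSweep (h ⊕ a)
    left-shift a = cong (λ q → ifLight m (wt (h ⊕ a)) (hasWeight (suc (m ℕ.+ m)) (wt (h ⊕ a) ℕ.+ wt q))) (begin
      linComb a R                                     ≡⟨ ⊕-cancel (linComb h R) (linComb a R) ⟨
      linComb h R ⊕ (linComb h R ⊕ linComb a R)       ≡⟨ cong (linComb h R ⊕_) (linComb-⊕ h a R) ⟨
      linComb h R ⊕ linComb (h ⊕ a) R                 ∎)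

    right-comm : ∀ b → right (linComb b Rᵀ) b ≡ rightSweep b
    right-comm b = cong (λ i → ifLight m (wt b) (hasWeight (suc (m ℕ.+ m)) i)) (ℕ.+-comm (wt (h ⊕ linComb b Rᵀ)) (wt b))

  heavy : ∀ j → let d = suc j ℕ.+ suc j in lightWords d (suc j) (rowBits R) ≡ 0 → lightWords d j (rowBits Rᵀ) ≡ 0 →
    ∀ {a} → a ≢ 𝟎 → d < wt (encode R a)
  heavy j lightˡ lightʳ {a} a≢𝟎 = subst (suc j ℕ.+ suc j <_) (sym (wt-++ a b)) bound
    where
    b = linComb a R

    b≢𝟎 : b ≢ 𝟎
    b≢𝟎 b≡𝟎 = a≢𝟎 (trans (sym (RRᵀ a)) (trans (cong (λ x → linComb x Rᵀ) b≡𝟎) (linComb-𝟎 Rᵀ)))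

    bound : suc j ℕ.+ suc j < wt a ℕ.+ wt b
    bound with wt a ℕ.≤? suc j | wt b ℕ.≤? j
    ... | yes a-light | _           = lightWords≡0 _ (suc j) R lightˡ a≢𝟎 a-light
    -- The right half `b` determines the word, its left half being `linComb b Rᵀ`, so the columns
    -- take over the role of the rows.
    ... | no  _       | yes b-light = subst (suc j ℕ.+ suc j <_)
      (trans (cong (λ x → wt b ℕ.+ wt x) (RRᵀ a)) (ℕ.+-comm (wt b) (wt a)))
      (lightWords≡0 _ j Rᵀ lightʳ b≢𝟎 b-light)
    -- The weight is at least (j + 2) + (j + 1), one more than 2(j + 1).
    ... | no  a-heavy | no  b-heavy = ℕ.+-mono-≤ (ℕ.≰⇒> a-heavy) (ℕ.≰⇒> b-heavy)

-- Linear equations for the weight distribution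

-- With f = evenFilter, g = oddFilter and ^ the Krawtchouk transform, the numbers
-- 2ⁿ f(w) − f^(w) − (−1)^(w/2) g^(w) vanish at all even w ≥ 12 other than the
-- target; g is −4 times the vector of the κᵢ. For n = 33 such f and g were found
-- by solving a linear system.
record Coefficients : Set where
  field
    target               : ℕ
    constant κ₁ κ₅ κ₉    : ℤ
    evenFilter oddFilter : List ℤ

  combine : ℤ → ℤ → ℤ → ℤ
  combine b₁ b₅ b₉ = κ₁ * b₁ + (κ₅ * b₅ + κ₉ * b₉)

  CodeIdentity : ℕ → ℕ → Set
  -- The case `p ≡ 0` is the zero word and fixes `constant`; weights 2 to 10 are left free, as no
  -- codeword has them.
  CodeIdentity n p = p ≡ 0 ⊎ 6 ≤ p →
    + (2 ℕ.^ n) * nth 0ℤ evenFilter (p ℕ.+ p)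
      + (-1ℤ * krawtchouk (n ℕ.+ n) (p ℕ.+ p) evenFilter
        + -1ℤ * (χ (odd p) * krawtchouk (n ℕ.+ n) (p ℕ.+ p) oddFilter))
    ≡ + (2 ℕ.^ n) * (+ 4 * (hasWeight target (p ℕ.+ p) + - constant * hasWeight 0 p))

  ShadowIdentity : ℕ → Set
  ShadowIdentity w = nth 0ℤ oddFilter w ≡ -[1+ 3 ] * combine (hasWeight 1 w) (hasWeight 5 w) (hasWeight 9 w)

  codeIdentity? : ∀ n → Dec (∀ {p} → p < suc n → CodeIdentity n p)
  codeIdentity? n = ℕ.allUpTo? (λ p → (p ℕ.≟ 0 ⊎-dec 6 ℕ.≤? p) →-dec (_ ℤ.≟ _)) (suc n)

  shadowIdentity? : ∀ n → Dec (∀ {w} → w < suc (n ℕ.+ n) → ShadowIdentity w)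
  shadowIdentity? n = ℕ.allUpTo? (λ w → _ ℤ.≟ _) (suc (n ℕ.+ n))

spread : List ℤ → List ℤ
spread []      = []
spread (x ∷ l) = x ∷ 0ℤ ∷ spread l

-- For even w, passing to 66 - w changes neither the transform of `evenFilter` nor (-1)^(w/2) times
-- that of `oddFilter`. This dictates how `evenFilter` differs at complementary weights: 3 and -1 at
-- `target` and its complement, -3c and c at 0 and 66 with c = `constant`. The factor 4 keeps these
-- values integral.
coefficients₁₂ coefficients₁₄ : Coefficients
coefficients₁₂ = record
  { target     = 12
  ; constant   = + 858
  ; κ₁         = + 832
  ; κ₅         = + 112
  ; κ₉         = + 8
  ; evenFilter = spread
      (- + 2574 ∷ - + 1362 ∷ - + 282 ∷ - + 159 ∷ - + 3 ∷ - + 9 ∷ + 3 ∷ List.replicate 20 0ℤ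
      List.++ - + 1 ∷ + 3 ∷ + 1 ∷ + 53 ∷ + 94 ∷ + 454 ∷ + 858 ∷ [])
  ; oddFilter  = 0ℤ ∷ spread (- + 3328 ∷ 0ℤ ∷ - + 448 ∷ 0ℤ ∷ - + 32 ∷ [])
  }
coefficients₁₄ = record
  { target     = 14
  ; constant   = + 18678
  ; κ₁         = - + 10688
  ; κ₅         = - + 848
  ; κ₉         = - + 24
  ; evenFilter = spread
      (- + 56034 ∷ - + 17022 ∷ - + 5247 ∷ - + 954 ∷ - + 225 ∷ + 21 ∷ 0ℤ ∷ + 3 ∷ List.replicate 18 0ℤ
      List.++ - + 1 ∷ 0ℤ ∷ - + 7 ∷ + 75 ∷ + 318 ∷ + 1749 ∷ + 5674 ∷ + 18678 ∷ [])
  ; oddFilter  = 0ℤ ∷ spread (+ 42752 ∷ 0ℤ ∷ + 3392 ∷ 0ℤ ∷ + 96 ∷ [])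
  }

codeIdentity₁₂ : ∀ {p} → p < 34 → Coefficients.CodeIdentity coefficients₁₂ 33 p
codeIdentity₁₂ = toWitness {a? = Coefficients.codeIdentity? coefficients₁₂ 33} _

shadowIdentity₁₂ : ∀ {w} → w < 67 → Coefficients.ShadowIdentity coefficients₁₂ w
shadowIdentity₁₂ = toWitness {a? = Coefficients.shadowIdentity? coefficients₁₂ 33} _

codeIdentity₁₄ : ∀ {p} → p < 34 → Coefficients.CodeIdentity coefficients₁₄ 33 p
codeIdentity₁₄ = toWitness {a? = Coefficients.codeIdentity? coefficients₁₄ 33} _

shadowIdentity₁₄ : ∀ {w} → w < 67 → Coefficients.ShadowIdentity coefficients₁₄ w
shadowIdentity₁₄ = toWitness {a? = Coefficients.shadowIdentity? coefficients₁₄ 33} _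

∑-δ≡1 : ∑ (δ {n}) ≡ 1ℤ
∑-δ≡1 {zero}  = refl
∑-δ≡1 {suc n} = trans (cong₂ _+_ (∑-δ≡1 {n}) (∑-0 {n})) (ℤ.+-identityʳ 1ℤ)

∑-linear₃ : ∀ p q r (f g h : Word n → ℤ) →
  ∑ (λ a → p * f a + (q * g a + r * h a)) ≡ p * ∑ f + (q * ∑ g + r * ∑ h)
∑-linear₃ p q r f g h = begin
  ∑ (λ a → p * f a + (q * g a + r * h a))
    ≡⟨ ∑-+ (λ a → p * f a) (λ a → q * g a + r * h a) ⟩
  ∑ (λ a → p * f a) + ∑ (λ a → q * g a + r * h a)
    ≡⟨ cong₂ _+_ (∑-*ˡ p f) (∑-+ (λ a → q * g a) (λ a → r * h a)) ⟩
  p * ∑ f + (∑ (λ a → q * g a) + ∑ (λ a → r * h a))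
    ≡⟨ cong (λ t → p * ∑ f + t) (cong₂ _+_ (∑-*ˡ q g) (∑-*ˡ r h)) ⟩
  p * ∑ f + (q * ∑ g + r * ∑ h) ∎

cancel-outer : ∀ x y → x + (-1ℤ * x + y) ≡ y
cancel-outer x y = begin
  x + (-1ℤ * x + y)   ≡⟨ ℤ.+-assoc x (-1ℤ * x) y ⟨
  x + -1ℤ * x + y     ≡⟨ cong (λ t → x + t + y) (ℤ.-1*i≡-i x) ⟩
  x + - x + y         ≡⟨ cong (λ t → t + y) (ℤ.+-inverseʳ x) ⟩
  0ℤ + y              ≡⟨ ℤ.+-identityˡ y ⟩
  y                   ∎

minus-constant : ∀ {x c y} → x + - c ≡ y → x ≡ c + y
minus-constant {x} {c} {y} eq = begin
  x                 ≡⟨ ℤ.+-identityʳ x ⟨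
  x + 0ℤ            ≡⟨ cong (λ t → x + t) (ℤ.+-inverseˡ c) ⟨
  x + (- c + c)     ≡⟨ ℤ.+-assoc x (- c) c ⟨
  x + - c + c       ≡⟨ cong (λ t → t + c) eq ⟩
  y + c             ≡⟨ ℤ.+-comm y c ⟩
  c + y             ∎

double-≤ : ∀ {p q} → p ℕ.+ p ≤ suc (q ℕ.+ q) → p ≤ q
double-≤ {p} {q} h with p ℕ.≤? q
... | yes p≤q = p≤q
... | no  p≰q = contradiction h (ℕ.<⇒≱ (ℕ.≤-trans
  (s≤s (ℕ.≤-reflexive (sym (ℕ.+-suc q q)))) (ℕ.+-mono-≤ (ℕ.≰⇒> p≰q) (ℕ.≰⇒> p≰q))))

-- Minimum distance and the two coefficients

module Extremal (R : Vec (Word n) n) (b₁ b₅ b₉ : ℕ) (certificate : Certificate R b₁ b₅ b₉) where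

  open Certificate certificate
  open Code R RRᵀ≡𝟏 RᵀR≡𝟏 public

  -- The counts rule out weights up to 10; evenness excludes 11, since 2p > 10 gives p ≥ 6.
  half≥6 : ∀ {a p} → a ≢ 𝟎 → wt (encode R a) ≡ p ℕ.+ p → 6 ≤ p
  half≥6 {a} {p} a≢𝟎 wt≡ = ℕ.≰⇒> λ p≤5 → ℕ.<⇒≱ (heavy 4 lightˡ lightʳ a≢𝟎)
    (ℕ.≤-trans (ℕ.≤-reflexive wt≡) (ℕ.+-mono-≤ p≤5 p≤5))

  heavy₁₂ : ∀ {a} → a ≢ 𝟎 → 12 ≤ wt (encode R a)
  heavy₁₂ {a} a≢𝟎 =
    let p , wt≡ , _ = encode-Halved rows a
        6≤p = half≥6 {p = p} a≢𝟎 wt≡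
    in ℕ.≤-trans (ℕ.+-mono-≤ 6≤p 6≤p) (ℕ.≤-reflexive (sym wt≡))

  codeWords : ℕ → ℤ
  codeWords i = ∑ λ a → hasWeight i (wt (encode R a))

  -- The index `suc N` makes the list of words of weight 12 nonempty; its head, compared with `𝟎`,
  -- attains the distance.
  hasMinDistance : ∀ {N} → A C 12 (suc N) → HasMinDistance C 12
  hasMinDistance (x ∷ _ , _ , _ , members) = record
    { attained = x , 𝟎 , proj₁ x∈C , IsSubspace.𝟎-mem isSubspace
               , (λ x≡𝟎 → contradiction (trans (sym (proj₂ x∈C)) (trans (cong wt x≡𝟎) (wt-𝟎 {n ℕ.+ n}))) λ ())
               , trans (cong wt (⊕-identityʳ x)) (proj₂ x∈C)
    ; minimal  = λ { (a , refl) (b , refl) x≢y → ℕ.≤-trans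
        (heavy₁₂ λ a⊕b≡𝟎 → x≢y (cong (encode R) (⊕≡𝟎⇒≡ a b a⊕b≡𝟎)))
        (ℕ.≤-reflexive (cong wt (encode-⊕ a b))) }
    }
    where x∈C = Equivalence.from (members x) (here refl)

  isCode : ∀ {N} → A C 12 (suc N) → Is[ n ℕ.+ n , n , 12 ]Code C
  isCode A₁₂ = record
    { isSubspace  = isSubspace
    ; dimension   = dimension
    ; minDistance = hasMinDistance A₁₂
    }

  module _ (K : Coefficients)
    (codeIdentity   : ∀ {p} → p < suc n → Coefficients.CodeIdentity K n p)
    (shadowIdentity : ∀ {w} → w < suc (n ℕ.+ n) → Coefficients.ShadowIdentity K w)
    where

    open Coefficients K

    -- The filter identity is summed over the code. The two terms in `evenFilter` cancel by
    -- MacWilliams for the code itself, the term in `oddFilter` becomes a sum over the shadow, and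
    -- the common factor 4 · 2ⁿ is divided out.
    codeWords-target : codeWords target ≡ constant + combine (shadowWords 1) (shadowWords 5) (shadowWords 9)
    codeWords-target = minus-constant (ℤ.*-cancelˡ-≡ (+ 4) _ _ (ℤ.*-cancelˡ-≡ N _ _ {{ℕ.m^n≢0 2 n}} (begin
      N * (+ 4 * (codeWords target + - constant))
        ≡⟨ cong (λ t → N * (+ 4 * (codeWords target + t))) (trans (cong (λ t → - constant * t) (∑-δ≡1 {n})) (ℤ.*-identityʳ (- constant))) ⟨
      N * (+ 4 * (codeWords target + - constant * ∑ {n} δ))
        ≡⟨ cong (λ t → N * (+ 4 * (codeWords target + t))) (∑-*ˡ {n} (- constant) δ) ⟨
      N * (+ 4 * (codeWords target + ∑ {n} (λ a → - constant * δ a)))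
        ≡⟨ cong (λ t → N * (+ 4 * t)) (∑-+ (λ a → hasWeight target (weight a)) (λ a → - constant * δ a)) ⟨
      N * (+ 4 * ∑ {n} (λ a → hasWeight target (weight a) + - constant * δ a))
        ≡⟨ trans (∑-*ˡ N (λ a → + 4 * (hasWeight target (weight a) + - constant * δ a))) (cong (λ t → N * t) (∑-*ˡ (+ 4) (λ a → hasWeight target (weight a) + - constant * δ a))) ⟨
      ∑ {n} (λ a → N * (+ 4 * (hasWeight target (weight a) + - constant * δ a)))
        ≡⟨ ∑-cong pointwise ⟨
      ∑ {n} (λ a → N * evenValue a + (-1ℤ * evenKrawtchouk a + -1ℤ * oddKrawtchouk a))
        ≡⟨ ∑-linear₃ N -1ℤ -1ℤ evenValue evenKrawtchouk oddKrawtchouk ⟩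
      N * ∑ {n} evenValue + (-1ℤ * ∑ {n} evenKrawtchouk + -1ℤ * ∑ {n} oddKrawtchouk)
        ≡⟨ cong₂ (λ s t → N * ∑ {n} evenValue + (-1ℤ * s + -1ℤ * t)) ∑-evenKrawtchouk ∑-oddKrawtchouk ⟩
      N * ∑ {n} evenValue + (-1ℤ * (N * ∑ {n} evenValue) + -1ℤ * (N * (-[1+ 3 ] * shadow)))
        ≡⟨ cancel-outer (N * ∑ {n} evenValue) _ ⟩
      -1ℤ * (N * (-[1+ 3 ] * shadow))
        ≡⟨ *-swapˡ -1ℤ N _ ⟩
      N * (-1ℤ * (-[1+ 3 ] * shadow))
        ≡⟨ cong (λ t → N * t) (ℤ.*-assoc -1ℤ -[1+ 3 ] shadow) ⟨
      N * (+ 4 * shadow) ∎)))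
      where
      N = + (2 ℕ.^ n)

      weight : Word n → ℕ
      weight a = wt (encode R a)

      shadow : ℤ
      shadow = combine (shadowWords 1) (shadowWords 5) (shadowWords 9)

      evenValue evenKrawtchouk oddKrawtchouk : Word n → ℤ
      evenValue      a = nth 0ℤ evenFilter (weight a)
      evenKrawtchouk a = krawtchouk (n ℕ.+ n) (weight a) evenFilter
      oddKrawtchouk  a = χ ⟨ encode R a , u ⟩ * krawtchouk (n ℕ.+ n) (weight a) oddFilter

      ∑-evenKrawtchouk : ∑ {n} evenKrawtchouk ≡ N * ∑ {n} evenValue
      ∑-evenKrawtchouk = begin
        ∑ {n} evenKrawtchouk
          ≡⟨ ∑-cong (λ a → trans (cong (λ b → χ b * evenKrawtchouk a) (⟨⟩-𝟎ʳ (encode R a))) (ℤ.*-identityˡ (evenKrawtchouk a))) ⟨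
        ∑ {n} (λ a → χ ⟨ encode R a , 𝟎 ⟩ * evenKrawtchouk a)
          ≡⟨ macWilliams 𝟎 evenFilter ⟩
        N * ∑ {n} (λ a → nth 0ℤ evenFilter (wt (𝟎 ⊕ encode R a)))
          ≡⟨ cong (λ t → N * t) (∑-cong λ a → cong (λ x → nth 0ℤ evenFilter (wt x)) (⊕-identityˡ (encode R a))) ⟩
        N * ∑ {n} evenValue ∎

      ∑-oddKrawtchouk : ∑ {n} oddKrawtchouk ≡ N * (-[1+ 3 ] * shadow)
      ∑-oddKrawtchouk = begin
        ∑ {n} oddKrawtchouk
          ≡⟨ macWilliams u oddFilter ⟩
        N * ∑ {n} (λ a → nth 0ℤ oddFilter (coset a))
          ≡⟨ cong (λ t → N * t) (∑-cong λ a → shadowIdentity (s≤s (wt≤n (u ⊕ encode R a)))) ⟩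
        N * ∑ {n} (λ a → -[1+ 3 ] * combine (hasWeight 1 (coset a)) (hasWeight 5 (coset a)) (hasWeight 9 (coset a)))
          ≡⟨ cong (λ t → N * t) (∑-*ˡ -[1+ 3 ] λ a → combine (hasWeight 1 (coset a)) (hasWeight 5 (coset a)) (hasWeight 9 (coset a))) ⟩
        N * (-[1+ 3 ] * ∑ {n} (λ a → combine (hasWeight 1 (coset a)) (hasWeight 5 (coset a)) (hasWeight 9 (coset a))))
          ≡⟨ cong (λ t → N * (-[1+ 3 ] * t)) (∑-linear₃ κ₁ κ₅ κ₉ (λ a → hasWeight 1 (coset a)) (λ a → hasWeight 5 (coset a)) (λ a → hasWeight 9 (coset a))) ⟩
        N * (-[1+ 3 ] * shadow) ∎
        where
        coset : Word n → ℕ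
        coset a = wt (u ⊕ encode R a)

      pointwise : ∀ a →
        N * evenValue a + (-1ℤ * evenKrawtchouk a + -1ℤ * oddKrawtchouk a)
          ≡ N * (+ 4 * (hasWeight target (weight a) + - constant * δ a))
      pointwise a with p , wt≡ , odd-p ← encode-Halved rows a = begin
        N * evenValue a + (-1ℤ * evenKrawtchouk a + -1ℤ * oddKrawtchouk a)
          ≡⟨ cong₂ (λ w b → N * nth 0ℤ evenFilter w + (-1ℤ * krawtchouk (n ℕ.+ n) w evenFilter + -1ℤ * (χ b * krawtchouk (n ℕ.+ n) w oddFilter))) wt≡ (sym odd-p) ⟩
        N * nth 0ℤ evenFilter (p ℕ.+ p) + (-1ℤ * krawtchouk (n ℕ.+ n) (p ℕ.+ p) evenFilter + -1ℤ * (χ (odd p) * krawtchouk (n ℕ.+ n) (p ℕ.+ p) oddFilter))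
          ≡⟨ codeIdentity p<1+n (proj₁ zero-or-heavy) ⟩
        N * (+ 4 * (hasWeight target (p ℕ.+ p) + - constant * hasWeight 0 p))
          ≡⟨ cong₂ (λ w t → N * (+ 4 * (hasWeight target w + - constant * t))) (sym wt≡) (proj₂ zero-or-heavy) ⟩
        N * (+ 4 * (hasWeight target (weight a) + - constant * δ a)) ∎
        where
        p<1+n : p < suc n
        p<1+n = s≤s (double-≤ (ℕ.m≤n⇒m≤1+n (ℕ.≤-trans (ℕ.≤-reflexive (sym wt≡)) (wt≤n (encode R a)))))

        -- `δ a` depends on the word, `hasWeight 0 p` on its weight alone; they agree because only
        -- the zero word has weight 0.
        zero-or-heavy : (p ≡ 0 ⊎ 6 ≤ p) × hasWeight 0 p ≡ δ a
        zero-or-heavy with a ≟𝟎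
        ... | yes refl = inj₁ p≡0 , trans (cong (hasWeight 0) p≡0) (sym (δ-𝟎 {n}))
          where
          p≡0 : p ≡ 0
          p≡0 = ℕ.m+n≡0⇒m≡0 p (trans (sym wt≡) (trans (cong wt encode-𝟎) (wt-𝟎 {n ℕ.+ n})))
        ... | no a≢𝟎 = inj₂ 6≤p , trans (cong +_ (nth-indicator-≢ λ p≡0 → ℕ.<⇒≱ (ℕ.≤-trans (s≤s z≤n) 6≤p) (ℕ.≤-reflexive p≡0))) (sym (δ-≢𝟎 a≢𝟎))
          where
          6≤p = half≥6 {p = p} a≢𝟎 wt≡

    target-size : ∀ N → constant + combine (+ b₁) (+ b₅) (+ b₉) ≡ + N → A C target N
    target-size N total = span-size (encode R) encode-injective target N (begin
      codeWords target
        ≡⟨ codeWords-target ⟩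
      constant + combine (shadowWords 1) (shadowWords 5) (shadowWords 9)
        ≡⟨ cong₂ (λ s t → constant + combine s t (shadowWords 9))
             (trans (shadowWords-odd 0) (cong +_ shadow₁))
             (trans (shadowWords-odd 2) (cong +_ shadow₅)) ⟩
      constant + combine (+ b₁) (+ b₅) (shadowWords 9)
        ≡⟨ cong (λ t → constant + combine (+ b₁) (+ b₅) t)
             (trans (shadowWords-odd 4) (cong +_ shadow₉)) ⟩
      constant + combine (+ b₁) (+ b₅) (+ b₉)
        ≡⟨ total ⟩
      + N ∎)

-- Both totals hold by `refl` at each use: (0, 0, β) gives 858 + 8β and 18678 - 24β, while (0, 1, β
-- - 14) gives 858 + 112 + 8(β - 14) = 858 + 8β and 18678 - 848 - 24(β - 14) = 18166 - 24β.
extremalCode : ∀ {R b₁ b₅ b₉ N₁₂ N₁₄} → Certificate {33} R b₁ b₅ b₉ →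
  + 858 + Coefficients.combine coefficients₁₂ (+ b₁) (+ b₅) (+ b₉) ≡ + suc N₁₂ →
  + 18678 + Coefficients.combine coefficients₁₄ (+ b₁) (+ b₅) (+ b₉) ≡ + N₁₄ →
  ∃ λ (C : Pred (Word 66) 0ℓ) → IsExtremalSelfDual[66,33,12] C × A C 12 (suc N₁₂) × A C 14 N₁₄
extremalCode {R} {b₁} {b₅} {b₉} {N₁₂} {N₁₄} certificate total₁₂ total₁₄ =
  C , (isCode A₁₂ , selfDual , hasMinDistance A₁₂) , A₁₂ , A₁₄
  where
  open Extremal R b₁ b₅ b₉ certificate
  A₁₂ : A C 12 (suc N₁₂)
  A₁₂ = target-size coefficients₁₂ codeIdentity₁₂ shadowIdentity₁₂ (suc N₁₂) total₁₂
  A₁₄ : A C 14 N₁₄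
  A₁₄ = target-size coefficients₁₄ codeIdentity₁₄ shadowIdentity₁₄ N₁₄ total₁₄

-- The ten codes

-- The least significant bit comes first.
bits : ∀ n → ℕ → Word n
bits zero    _ = []
bits (suc n) x = (x % 2 ≡ᵇ 1) ∷ bits n (x / 2)

-- The codes come from [64,32,12] codes C (four-circulant over abelian groups of
-- order 16 for W₆₆,₁, bordered four-circulant for W₆₆,₃) by the building-up
-- construction: for a vector x of odd weight with x + C of minimum weight at least
-- 11, a word c of C is prefixed by 00 or 11 according to ⟨ c , x ⟩, and 10x is
-- adjoined.

rows₁-13 : Vec (Word 33) 33
rows₁-13 = map (bits 33) (
    0x0B8900B82 ∷ 0x0B59190E9 ∷ 0x079C4B262 ∷ 0x12E0F6213 ∷ 0x072E9B316 ∷ 0x07B071CF2 ∷ 0x0FCE8425D ∷ 0x0DE449E42 ∷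
    0x0C28EE08F ∷ 0x1D06252A8 ∷ 0x0B756EBE0 ∷ 0x13B1DE9EE ∷ 0x14EE8CC63 ∷ 0x1D794FC43 ∷ 0x1E434A6BA ∷ 0x09871445C ∷
    0x17C1028D4 ∷ 0x15009364D ∷ 0x090C285A2 ∷ 0x00EB22FC7 ∷ 0x1A9842F76 ∷ 0x0EDB01442 ∷ 0x1915B74C0 ∷ 0x09A79BF6B ∷
    0x15FAFECB6 ∷ 0x0996A8825 ∷ 0x0395E9D10 ∷ 0x114291B58 ∷ 0x06570B08A ∷ 0x0612C4ECD ∷ 0x1C6C807AA ∷ 0x1C3258804 ∷
    0x1E29572A0 ∷ [])

certificate₁-13 : Certificate rows₁-13 0 0 13
certificate₁-13 = toWitness {a? = certificate? rows₁-13 0 0 13} _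

rows₁-57 : Vec (Word 33) 33
rows₁-57 = map (bits 33) (
    0x1DD4EF8E6 ∷ 0x096FC602C ∷ 0x1BC69B9F0 ∷ 0x00535D309 ∷ 0x15A52C1AF ∷ 0x0882D5B6C ∷ 0x1634F6141 ∷ 0x1CA85121F ∷
    0x14255B405 ∷ 0x0EF3303D8 ∷ 0x0A1250E71 ∷ 0x00BBAEDD6 ∷ 0x17EB0F79F ∷ 0x073E89BB9 ∷ 0x0247BEB94 ∷ 0x0C7B0FA8F ∷
    0x04B9B04D3 ∷ 0x03DF5BDFA ∷ 0x0296FFF8E ∷ 0x0094F074A ∷ 0x0E3352910 ∷ 0x12655D674 ∷ 0x19724FBA5 ∷ 0x0F2F68340 ∷
    0x1B8388D6D ∷ 0x042F89137 ∷ 0x09BD09064 ∷ 0x044A48CCD ∷ 0x0BEC9C352 ∷ 0x187985F2C ∷ 0x0555CD81A ∷ 0x1BDEE22C5 ∷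
    0x19D656D28 ∷ [])

certificate₁-57 : Certificate rows₁-57 0 0 57
certificate₁-57 = toWitness {a? = certificate? rows₁-57 0 0 57} _

rows₃-24 : Vec (Word 33) 33
rows₃-24 = map (bits 33) (
    0x0900F442A ∷ 0x0E57F9112 ∷ 0x0FC9B1450 ∷ 0x1D6D12BEA ∷ 0x0B886A7BF ∷ 0x1797D5CB3 ∷ 0x0FF3F0A8F ∷ 0x1F9335B16 ∷
    0x09A75917C ∷ 0x145416520 ∷ 0x0FC13AA9A ∷ 0x038AB97E4 ∷ 0x1AD820026 ∷ 0x191F33037 ∷ 0x14169C047 ∷ 0x03676D385 ∷
    0x0B1966E44 ∷ 0x04E278113 ∷ 0x1A9C4CA89 ∷ 0x05EC919F1 ∷ 0x17F82211A ∷ 0x1873EDFCA ∷ 0x0F4CAE49A ∷ 0x1A8F56643 ∷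
    0x17E3183B2 ∷ 0x10E890687 ∷ 0x1762841BF ∷ 0x0BE8074DB ∷ 0x04C6F86EF ∷ 0x0FE4B0C28 ∷ 0x16A5DEA84 ∷ 0x1B83F967E ∷
    0x143B95353 ∷ [])

certificate₃-24 : Certificate rows₃-24 0 1 10
certificate₃-24 = toWitness {a? = certificate? rows₃-24 0 1 10} _

rows₃-25 : Vec (Word 33) 33
rows₃-25 = map (bits 33) (
    0x052FBF8FF ∷ 0x099A945B4 ∷ 0x16C316F32 ∷ 0x0D9D44FCD ∷ 0x1E62D1B0E ∷ 0x1C4222E13 ∷ 0x06F590FF4 ∷ 0x0590BFA7B ∷
    0x118D5E8AD ∷ 0x0F16B8BA4 ∷ 0x0CEDFA992 ∷ 0x1E4FEEB54 ∷ 0x1D2FF6D3D ∷ 0x11CD84BAB ∷ 0x17A109D2F ∷ 0x14512FDC6 ∷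
    0x186695E30 ∷ 0x1EBD3062F ∷ 0x1D65F1738 ∷ 0x096DCC59C ∷ 0x0162FBF17 ∷ 0x11710D330 ∷ 0x199262E7A ∷ 0x10C5EAC83 ∷
    0x1782D3245 ∷ 0x03182D4AC ∷ 0x19B0535C8 ∷ 0x0C055FF76 ∷ 0x095BB8B91 ∷ 0x191337ED5 ∷ 0x137E3E2F5 ∷ 0x1001A1ECE ∷
    0x13F5F8424 ∷ [])

certificate₃-25 : Certificate rows₃-25 0 1 11
certificate₃-25 = toWitness {a? = certificate? rows₃-25 0 1 11} _

rows₃-26 : Vec (Word 33) 33
rows₃-26 = map (bits 33) (
    0x058391DDE ∷ 0x02D49C8E6 ∷ 0x0FC9B1450 ∷ 0x11EE7721D ∷ 0x0B886A7BC ∷ 0x1797D5CB0 ∷ 0x0FF3F0A8F ∷ 0x1310502E1 ∷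
    0x09A75917F ∷ 0x145416520 ∷ 0x03425F36D ∷ 0x038AB97E7 ∷ 0x165B459D2 ∷ 0x191F33037 ∷ 0x0FE408A71 ∷ 0x14169C044 ∷
    0x0B1966E44 ∷ 0x04E278110 ∷ 0x161F2937E ∷ 0x096FF4005 ∷ 0x1B7B478EE ∷ 0x14F08863E ∷ 0x03CFCBD6D ∷ 0x1A8F56640 ∷
    0x1B607DA45 ∷ 0x10E890684 ∷ 0x1762841BF ∷ 0x0BE8074D8 ∷ 0x04C6F86EC ∷ 0x0FE4B0C28 ∷ 0x16A5DEA84 ∷ 0x17009CF8A ∷
    0x143B95353 ∷ [])

certificate₃-26 : Certificate rows₃-26 0 1 12
certificate₃-26 = toWitness {a? = certificate? rows₃-26 0 1 12} _

rows₃-27 : Vec (Word 33) 33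
rows₃-27 = map (bits 33) (
    0x0BFC69017 ∷ 0x15274433C ∷ 0x0FDD9AD53 ∷ 0x09552EB24 ∷ 0x1F4E72B0E ∷ 0x061BF390B ∷ 0x08130B52D ∷ 0x071FFDF6C ∷
    0x0340AE561 ∷ 0x19D347D1E ∷ 0x0B7B003F0 ∷ 0x03B9ADA10 ∷ 0x11EDA40E7 ∷ 0x0222E1198 ∷ 0x0921F3212 ∷ 0x1E4F35467 ∷
    0x064AD6BC3 ∷ 0x06FE06541 ∷ 0x1E52D9E36 ∷ 0x14D3D17A1 ∷ 0x0ABC7641B ∷ 0x14EAA16B9 ∷ 0x07829A746 ∷ 0x02E65B365 ∷
    0x1D8F62AFD ∷ 0x0DCF9C289 ∷ 0x09BECD9ED ∷ 0x15E3AC48B ∷ 0x1AFFB9B6C ∷ 0x12DA7CDC6 ∷ 0x103B64B2A ∷ 0x169F23F75 ∷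
    0x149E05201 ∷ [])

certificate₃-27 : Certificate rows₃-27 0 1 13
certificate₃-27 = toWitness {a? = certificate? rows₃-27 0 1 13} _

rows₃-39 : Vec (Word 33) 33
rows₃-39 = map (bits 33) (
    0x1F1405336 ∷ 0x114D49849 ∷ 0x162F1E552 ∷ 0x111623490 ∷ 0x1A8DDE52B ∷ 0x029970B06 ∷ 0x05C21BF72 ∷ 0x06FF1151A ∷
    0x0E4967279 ∷ 0x0956BB8AF ∷ 0x18A5C4EC2 ∷ 0x16BBCDF15 ∷ 0x0F9E67D99 ∷ 0x00053E566 ∷ 0x1EA8F5815 ∷ 0x03B75EA77 ∷
    0x1610B41AC ∷ 0x064839265 ∷ 0x1B1ABFD6A ∷ 0x14901AC66 ∷ 0x186EBF206 ∷ 0x0C592EC2A ∷ 0x02F84A02B ∷ 0x0CBE9C1ED ∷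
    0x09A1B03F1 ∷ 0x1C78743CC ∷ 0x1208BB9B1 ∷ 0x18CE33672 ∷ 0x098015B9C ∷ 0x1B8479DB5 ∷ 0x00C6D730D ∷ 0x01D8ED226 ∷
    0x1F9578548 ∷ [])

certificate₃-39 : Certificate rows₃-39 0 1 25
certificate₃-39 = toWitness {a? = certificate? rows₃-39 0 1 25} _

rows₃-40 : Vec (Word 33) 33
rows₃-40 = map (bits 33) (
    0x08E676FD2 ∷ 0x122BBF695 ∷ 0x0C18664F6 ∷ 0x03B0A1199 ∷ 0x1DC4CE2D7 ∷ 0x13F10279B ∷ 0x0D8340ECE ∷ 0x15AD54A12 ∷
    0x007B899A0 ∷ 0x1BDFA7F62 ∷ 0x1F0434FA5 ∷ 0x0C89B8897 ∷ 0x0B8BB4647 ∷ 0x092CFCE75 ∷ 0x18001ABD3 ∷ 0x0A4DEA468 ∷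
    0x0588CF218 ∷ 0x0AB3BFA54 ∷ 0x1966FB3CE ∷ 0x1022FF97B ∷ 0x1C75FF29C ∷ 0x0A233A599 ∷ 0x09EC99C9C ∷ 0x07C74DAB9 ∷
    0x136529B3C ∷ 0x1F3930590 ∷ 0x1F020B14F ∷ 0x103561ED4 ∷ 0x0D15DCC7B ∷ 0x1C15A1FBE ∷ 0x195553DFD ∷ 0x070CDF16A ∷
    0x1672D4982 ∷ [])

certificate₃-40 : Certificate rows₃-40 0 1 26
certificate₃-40 = toWitness {a? = certificate? rows₃-40 0 1 26} _

rows₃-41 : Vec (Word 33) 33
rows₃-41 = map (bits 33) (
    0x045890D1E ∷ 0x1A7D4B614 ∷ 0x1F0E7F084 ∷ 0x1BB6752D8 ∷ 0x1F01174F0 ∷ 0x053D1F34F ∷ 0x11AFA7416 ∷ 0x129E34859 ∷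
    0x0F0B0A9FF ∷ 0x0FF6AB20B ∷ 0x0602AA59F ∷ 0x164FA6AA2 ∷ 0x028220BEB ∷ 0x1BDA8639D ∷ 0x0FA57FD08 ∷ 0x02A95D5CB ∷
    0x1CD95AB63 ∷ 0x0E66D3F16 ∷ 0x14DD3270E ∷ 0x015C5F081 ∷ 0x182989DE2 ∷ 0x0E9E62F2D ∷ 0x03433A0B8 ∷ 0x00407CFD0 ∷
    0x007312C56 ∷ 0x0798D7E5C ∷ 0x0A8CBFF79 ∷ 0x1124DC624 ∷ 0x151B3B1EE ∷ 0x1848E00FA ∷ 0x0B8A33CE0 ∷ 0x133A03377 ∷
    0x03A1982AC ∷ [])

certificate₃-41 : Certificate rows₃-41 0 1 27
certificate₃-41 = toWitness {a? = certificate? rows₃-41 0 1 27} _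

rows₃-42 : Vec (Word 33) 33
rows₃-42 = map (bits 33) (
    0x08D33610A ∷ 0x068A7AA76 ∷ 0x01E82D76D ∷ 0x111623490 ∷ 0x1A8DDE528 ∷ 0x155E43939 ∷ 0x120528D4D ∷ 0x113822725 ∷
    0x198E54046 ∷ 0x0956BB8AC ∷ 0x0F62F7CFD ∷ 0x017CFED29 ∷ 0x185954FA6 ∷ 0x17C20D759 ∷ 0x03B75EA77 ∷ 0x096FC6A2A ∷
    0x1610B41AC ∷ 0x118F0A05A ∷ 0x0CDD8CF56 ∷ 0x035729E59 ∷ 0x0FA98C03A ∷ 0x1B9E1DE15 ∷ 0x02F84A02B ∷ 0x1B79AF3D1 ∷
    0x1E66831CD ∷ 0x1C78743CC ∷ 0x05CF88B8D ∷ 0x0F090044E ∷ 0x098015B9C ∷ 0x0C434AF8A ∷ 0x1701E4131 ∷ 0x161FDE01A ∷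
    0x1F9578548 ∷ [])

certificate₃-42 : Certificate rows₃-42 0 1 28
certificate₃-42 = toWitness {a? = certificate? rows₃-42 0 1 28} _

mainTheorem2 : (∀ (β : ℕ) → β ∈ (13 ∷ 57 ∷ []) →
    ∃ λ (C : Pred (Word 66) 0ℓ) → IsExtremalSelfDual[66,33,12] C × HasW₆₆,₁ C β)
    ×
    (∀ (β : ℕ) → β ∈ (24 ∷ 25 ∷ 26 ∷ 27 ∷ 39 ∷ 40 ∷ 41 ∷ 42 ∷ []) →
    ∃ λ (C : Pred (Word 66) 0ℓ) → IsExtremalSelfDual[66,33,12] C × HasW₆₆,₃ C β)
mainTheorem2 = part₁ , part₂
  where
  part₁ : ∀ β → β ∈ (13 ∷ 57 ∷ []) →
    ∃ λ (C : Pred (Word 66) 0ℓ) → IsExtremalSelfDual[66,33,12] C × HasW₆₆,₁ C β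
  part₁ _ (here refl) =
    let C , extremal , A₁₂ , A₁₄ = extremalCode certificate₁-13 refl refl
    in C , extremal , ℕ.≤ᵇ⇒≤ 0 13 _ , ℕ.≤ᵇ⇒≤ 13 778 _ , A₁₂ , A₁₄
  part₁ _ (there (here refl)) =
    let C , extremal , A₁₂ , A₁₄ = extremalCode certificate₁-57 refl refl
    in C , extremal , ℕ.≤ᵇ⇒≤ 0 57 _ , ℕ.≤ᵇ⇒≤ 57 778 _ , A₁₂ , A₁₄

  part₂ : ∀ β → β ∈ (24 ∷ 25 ∷ 26 ∷ 27 ∷ 39 ∷ 40 ∷ 41 ∷ 42 ∷ []) →
    ∃ λ (C : Pred (Word 66) 0ℓ) → IsExtremalSelfDual[66,33,12] C × HasW₆₆,₃ C β
  part₂ _ (here refl) =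
    let C , extremal , A₁₂ , A₁₄ = extremalCode certificate₃-24 refl refl
    in C , extremal , ℕ.≤ᵇ⇒≤ 14 24 _ , ℕ.≤ᵇ⇒≤ 24 756 _ , A₁₂ , A₁₄
  part₂ _ (there (here refl)) =
    let C , extremal , A₁₂ , A₁₄ = extremalCode certificate₃-25 refl refl
    in C , extremal , ℕ.≤ᵇ⇒≤ 14 25 _ , ℕ.≤ᵇ⇒≤ 25 756 _ , A₁₂ , A₁₄
  part₂ _ (there (there (here refl))) =
    let C , extremal , A₁₂ , A₁₄ = extremalCode certificate₃-26 refl refl
    in C , extremal , ℕ.≤ᵇ⇒≤ 14 26 _ , ℕ.≤ᵇ⇒≤ 26 756 _ , A₁₂ , A₁₄
  part₂ _ (there (there (there (here refl)))) =
    let C , extremal , A₁₂ , A₁₄ = extremalCode certificate₃-27 refl refl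
    in C , extremal , ℕ.≤ᵇ⇒≤ 14 27 _ , ℕ.≤ᵇ⇒≤ 27 756 _ , A₁₂ , A₁₄
  part₂ _ (there (there (there (there (here refl))))) =
    let C , extremal , A₁₂ , A₁₄ = extremalCode certificate₃-39 refl refl
    in C , extremal , ℕ.≤ᵇ⇒≤ 14 39 _ , ℕ.≤ᵇ⇒≤ 39 756 _ , A₁₂ , A₁₄
  part₂ _ (there (there (there (there (there (here refl)))))) =
    let C , extremal , A₁₂ , A₁₄ = extremalCode certificate₃-40 refl refl
    in C , extremal , ℕ.≤ᵇ⇒≤ 14 40 _ , ℕ.≤ᵇ⇒≤ 40 756 _ , A₁₂ , A₁₄
  part₂ _ (there (there (there (there (there (there (here refl))))))) =
    let C , extremal , A₁₂ , A₁₄ = extremalCode certificate₃-41 refl refl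
    in C , extremal , ℕ.≤ᵇ⇒≤ 14 41 _ , ℕ.≤ᵇ⇒≤ 41 756 _ , A₁₂ , A₁₄
  part₂ _ (there (there (there (there (there (there (there (here refl)))))))) =
    let C , extremal , A₁₂ , A₁₄ = extremalCode certificate₃-42 refl refl
    in C , extremal , ℕ.≤ᵇ⇒≤ 14 42 _ , ℕ.≤ᵇ⇒≤ 42 756 _ , A₁₂ , A₁₄
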